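{- Let $v\ge 2$, $l\ge 1$ and $t\ge1$ be integers, put $n=vl$, and assume $n\ge 2vt$. Let $B$ be the set of sequences $\sigma\in\mathbb{Z}_v^n$ (indexed by $\mathbb{Z}_n$) in which every symbol occurs exactly $l$ times, and choose $\sigma\in B$ uniformly at random. For $b\in\mathbb{Z}_v$ let $$\rho(b,t)=\#\{i\in\mathbb{Z}_n:\ \sigma(i-1)\neq b,\ \sigma(i+t)\neq b,\ \sigma(i+\iota)=b\text{ for all }0\le\iota<t\},$$ indices taken modulo $n$. Then $$E(\rho(b,t))=\frac{(l(v-1)-1)(v-1)\,l\,(l)_t}{(n-1)_{t+1}},$$ $$\mathrm{VAR}(\rho(b,t))=\frac{(l(v-1)-1)(v-1)l(l)_t}{(n-1)_{t+1}}-\left(\frac{(l(v-1)-1)(v-1)l(l)_t}{(n-1)_{t+1}}\right)^2+\frac{(v-1)\,l\,(l)_{2t}\,(l(v-1)-1)^2\,(l(v-1)-2)}{(n-1)_{2t+2}}.$$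
   Context: $(x)_m=x(x-1)\cdots(x-m+1)$ denotes the falling factorial. $\rho(b,t)$ is the number of (cyclic) runs of symbol $b$ of length exactly $t$ in $\sigma$.
   Formalization: The variance formula is claimed except when v=l=2 and t=1 (n=4): there (n-1)_{2t+2}=(3)_4=0 and l(v-1)-2=0, so its last term reads 0/0 and is undefined. The formula for the mean is claimed in all cases. -}

module Defs where

open import Data.Nat.Base as ℕ using (ℕ; zero; suc; _≤_; _<_; _≥_; z≤n; s≤s; NonZero)
open import Data.Nat.Properties as ℕₚ using (allUpTo?)
open import Data.Nat.Combinatorics using (_P_)
open import Data.Nat.Combinatorics.Base using (_P′_)
open import Data.Integer.Base as ℤ using (ℤ; +_; 1ℤ)
open import Data.Integer.DivMod using (n%ℕd<d)
open import Data.Rational.Base as ℚ using (ℚ; 0ℚ; _+_; _-_; _*_; _/_)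
open import Data.Fin.Base using (Fin; zero; suc; toℕ; fromℕ<)
open import Data.Fin.Properties as Finₚ using (_≟_; nonZeroIndex)
open import Data.Vec.Base as Vec using (Vec; []; _∷_; lookup; count)
open import Data.List.Base as List using (List; length; filter; foldr)
open import Data.List.Membership.Propositional using (_∈_)
open import Data.List.Membership.Propositional.Properties
  using (∈-filter⁺; ∈-allFin; ∈-cartesianProductWith⁺; ∈-length)
open import Data.List.Relation.Unary.Any using (here)
open import Data.Product.Base using (_×_; _,_)
open import Data.Bool.Base using (true; false)
open import Function.Base using (_∘_)
open import Relation.Nullary using (¬_; does; yes; no; contradiction)
open import Relation.Nullary.Decidable using (_×-dec_; ¬?)
open import Relation.Unary using (Decidable)
open import Relation.Binary.PropositionalEquality

private
  variable
    A : Set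
    v n : ℕ

------------------------------------------------------------------------
-- Uniform distribution on the entries of a non-empty list

module _ (Ω : List A) .{{_ : NonZero (length Ω)}} where

  𝔼 : (A → ℚ) → ℚ
  𝔼 X = foldr _+_ 0ℚ (List.map X Ω) * (1ℤ / length Ω)

  VAR : (A → ℚ) → ℚ
  VAR X = 𝔼 (λ ω → (X ω - 𝔼 X) * (X ω - 𝔼 X))

------------------------------------------------------------------------
-- Balanced sequences

-- Every sequence is listed exactly once.

sequences : ∀ v n → List (Vec (Fin v) n)
sequences v zero    = List.[ [] ]
sequences v (suc n) = List.cartesianProductWith _∷_ (List.allFin v) (sequences v n)

Balanced : ℕ → Vec (Fin v) n → Set
Balanced l σ = ∀ c → count (_≟ c) σ ≡ l

balanced? : ∀ l → Decidable (Balanced {v} {n} l)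
balanced? l σ = Finₚ.all? λ c → count (_≟ c) σ ℕₚ.≟ l

B : ∀ v l → List (Vec (Fin v) (v ℕ.* l))
B v l = filter (balanced? l) (sequences v (v ℕ.* l))

------------------------------------------------------------------------
-- Cyclic runs

-- The entry of σ at an integer index, read modulo the length n.

infix 9 _⟨_⟩

_⟨_⟩ : Vec A n → ℤ → .{{NonZero n}} → A
_⟨_⟩ {n = n} σ k = lookup σ (fromℕ< (n%ℕd<d k n))

module _ (σ : Vec (Fin v) n) (b : Fin v) (t : ℕ) where

  RunAt : .{{NonZero n}} → ℤ → Set
  RunAt i = σ ⟨ i ℤ.- 1ℤ ⟩ ≢ b
          × σ ⟨ i ℤ.+ + t ⟩ ≢ b
          × (∀ {ι} → ι < t → σ ⟨ i ℤ.+ + ι ⟩ ≡ b)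

  runAt? : .{{_ : NonZero n}} → Decidable RunAt
  runAt? i = ¬? (σ ⟨ i ℤ.- 1ℤ ⟩ ≟ b)
       ×-dec ¬? (σ ⟨ i ℤ.+ + t ⟩ ≟ b)
       ×-dec allUpTo? (λ ι → σ ⟨ i ℤ.+ + ι ⟩ ≟ b) t

  ρ : ℕ
  ρ = length (filter (λ i → runAt? {{nonZeroIndex i}} (+ toℕ i)) (List.allFin n))

------------------------------------------------------------------------
-- B is non-empty

private
  ∈-sequences : (σ : Vec (Fin v) n) → σ ∈ sequences v n
  ∈-sequences []      = here refl
  ∈-sequences (x ∷ σ) = ∈-cartesianProductWith⁺ _∷_ (∈-allFin x) (∈-sequences σ)

  blocks : ∀ l → Vec A n → Vec A (n ℕ.* l)
  blocks l xs = Vec.concat (Vec.map (Vec.replicate l) xs)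

  module _ {P : A → Set} (P? : Decidable P) where

    count-++ : ∀ {m n} (xs : Vec A m) (ys : Vec A n) →
               count P? (xs Vec.++ ys) ≡ count P? xs ℕ.+ count P? ys
    count-++ []       ys = refl
    count-++ (x ∷ xs) ys with does (P? x)
    ... | true  = cong suc (count-++ xs ys)
    ... | false = count-++ xs ys

    count-replicate : ∀ l x → count P? (Vec.replicate l x) ≡ count P? (x ∷ []) ℕ.* l
    count-replicate zero    x = sym (ℕₚ.*-zeroʳ (count P? (x ∷ [])))
    count-replicate (suc l) x with does (P? x) | count-replicate l x
    ... | true  | ih = cong suc ih
    ... | false | ih = ih

    count-blocks : ∀ l (xs : Vec A n) → count P? (blocks l xs) ≡ count P? xs ℕ.* l
    count-blocks l []       = refl
    count-blocks l (x ∷ xs) = begin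
      count P? (Vec.replicate l x Vec.++ blocks l xs)
        ≡⟨ count-++ (Vec.replicate l x) (blocks l xs) ⟩
      count P? (Vec.replicate l x) ℕ.+ count P? (blocks l xs)
        ≡⟨ cong₂ ℕ._+_ (count-replicate l x) (count-blocks l xs) ⟩
      count P? (x ∷ []) ℕ.* l ℕ.+ count P? xs ℕ.* l
        ≡⟨ ℕₚ.*-distribʳ-+ l (count P? (x ∷ [])) (count P? xs) ⟨
      (count P? (x ∷ []) ℕ.+ count P? xs) ℕ.* l
        ≡⟨ cong (ℕ._* l) (sym (count-++ (x ∷ []) xs)) ⟩
      count P? (x ∷ xs) ℕ.* l ∎
      where open ≡-Reasoning

  count-none : (f : Fin n → Fin v) (c : Fin v) → (∀ i → f i ≢ c) →
               count (_≟ c) (Vec.tabulate f) ≡ 0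
  count-none {n = zero}  f c f≢c = refl
  count-none {n = suc n} f c f≢c with f zero ≟ c
  ... | yes f0≡c = contradiction f0≡c (f≢c zero)
  ... | no  _    = count-none (f ∘ suc) c (f≢c ∘ suc)

  count-injective : (f : Fin n → Fin v) → (∀ {i j} → f i ≡ f j → i ≡ j) →
                    ∀ i → count (_≟ f i) (Vec.tabulate f) ≡ 1
  count-injective f inj zero with f zero ≟ f zero
  ... | yes _   = cong suc (count-none (f ∘ suc) (f zero) λ i eq → contradiction (inj eq) λ ())
  ... | no  0≢0 = contradiction refl 0≢0
  count-injective f inj (suc i) with f zero ≟ f (suc i)
  ... | yes eq = contradiction (inj eq) λ ()
  ... | no  _  = count-injective (f ∘ suc) (Finₚ.suc-injective ∘ inj) i

  blocks-balanced : ∀ v l → Balanced l (blocks l (Vec.allFin v))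
  blocks-balanced v l c = begin
    count (_≟ c) (blocks l (Vec.allFin v)) ≡⟨ count-blocks (_≟ c) l (Vec.allFin v) ⟩
    count (_≟ c) (Vec.allFin v) ℕ.* l      ≡⟨ cong (ℕ._* l) (count-injective (λ i → i) (λ eq → eq) c) ⟩
    1 ℕ.* l                                ≡⟨ ℕₚ.*-identityˡ l ⟩
    l                                      ∎
    where open ≡-Reasoning

B-nonEmpty : ∀ v l → NonZero (length (B v l))
B-nonEmpty v l = ℕ.>-nonZero
  (∈-length (∈-filter⁺ (balanced? l) (∈-sequences (blocks l (Vec.allFin v))) (blocks-balanced v l)))

------------------------------------------------------------------------
-- The denominators do not vanish

private
  P′-nonZero : ∀ n k → k ≤ n → NonZero (n P′ k)
  P′-nonZero n zero    _   = _
  P′-nonZero n (suc k) k<n = ℕₚ.m*n≢0 (n ℕ.∸ k) (n P′ k)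
    {{ℕ.>-nonZero (ℕₚ.m<n⇒0<n∸m k<n)}} {{P′-nonZero n k (ℕₚ.<⇒≤ k<n)}}

  P-nonZero : ∀ {n k} → k ≤ n → NonZero (n P k)
  P-nonZero {n} {k} k≤n with k ℕ.≤ᵇ n | ℕₚ.≤⇒≤ᵇ k≤n
  ... | true | _ = P′-nonZero n k k≤n

  4t≤2vt : ∀ {v} t → v ≥ 2 → 4 ℕ.* t ≤ 2 ℕ.* v ℕ.* t
  4t≤2vt t v≥2 = ℕₚ.*-monoˡ-≤ t (ℕₚ.*-monoʳ-≤ 2 v≥2)

  variance-bound : ∀ v l t → v ≥ 2 → t ≥ 1 → v ℕ.* l ≥ 2 ℕ.* v ℕ.* t →
                   ¬ (v ≡ 2 × l ≡ 2 × t ≡ 1) → 2 ℕ.* t ℕ.+ 3 ≤ v ℕ.* l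
  variance-bound v l (suc (suc t)) v≥2 t≥1 n≥2vt _ = begin
    2 ℕ.* (2 ℕ.+ t) ℕ.+ 3
      ≤⟨ ℕₚ.+-monoʳ-≤ (2 ℕ.* (2 ℕ.+ t)) (ℕₚ.≤-trans (ℕₚ.n≤1+n 3) (ℕₚ.*-monoʳ-≤ 2 (ℕₚ.m≤m+n 2 t))) ⟩
    2 ℕ.* (2 ℕ.+ t) ℕ.+ 2 ℕ.* (2 ℕ.+ t) ≡⟨ ℕₚ.*-distribʳ-+ (2 ℕ.+ t) 2 2 ⟨
    4 ℕ.* (2 ℕ.+ t)                     ≤⟨ 4t≤2vt (2 ℕ.+ t) v≥2 ⟩
    2 ℕ.* v ℕ.* (2 ℕ.+ t)               ≤⟨ n≥2vt ⟩
    v ℕ.* l                             ∎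
    where open ℕₚ.≤-Reasoning
  variance-bound 2 0 1 _ _ () _
  variance-bound 2 1 1 _ _ (s≤s (s≤s ())) _
  variance-bound 2 2 1 _ _ _ ≢221 = contradiction (refl , refl , refl) ≢221
  variance-bound 2 (suc (suc (suc l))) 1 _ _ _ _ =
    ℕₚ.≤-trans (ℕₚ.n≤1+n 5) (ℕₚ.*-monoʳ-≤ 2 (ℕₚ.m≤m+n 3 l))
  variance-bound (suc (suc (suc v))) l 1 _ _ n≥2v _ = ℕₚ.≤-trans (ℕₚ.≤-trans (ℕₚ.n≤1+n 5)
    (ℕₚ.*-monoˡ-≤ 1 (ℕₚ.*-monoʳ-≤ 2 (ℕₚ.m≤m+n 3 v)))) n≥2v
  variance-bound 1 _ 1 (s≤s ()) _ _ _

module _ {v l t : ℕ} (v≥2 : v ≥ 2) (t≥1 : t ≥ 1) (n≥2vt : v ℕ.* l ≥ 2 ℕ.* v ℕ.* t) where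

  mean-denominator : NonZero ((v ℕ.* l ℕ.∸ 1) P (t ℕ.+ 1))
  mean-denominator = P-nonZero (ℕₚ.∸-monoˡ-≤ 1 (begin
    1 ℕ.+ (t ℕ.+ 1) ≡⟨ cong suc (ℕₚ.+-comm t 1) ⟩
    2 ℕ.+ t         ≡⟨ ℕₚ.+-comm 2 t ⟩
    t ℕ.+ 2         ≤⟨ ℕₚ.+-monoʳ-≤ t (ℕₚ.≤-trans (ℕₚ.n≤1+n 2) (ℕₚ.*-monoʳ-≤ 3 t≥1)) ⟩
    4 ℕ.* t         ≤⟨ 4t≤2vt t v≥2 ⟩
    2 ℕ.* v ℕ.* t   ≤⟨ n≥2vt ⟩
    v ℕ.* l         ∎))
    where open ℕₚ.≤-Reasoning

  -- For v = l = 2 and t = 1 the denominator is 3 · 2 · 1 · 0 and the numerator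
  -- contains l(v-1) - 2 = 0, so the last term of the variance reads 0/0. No
  -- other parameters have to be excluded.
  variance-denominator : ¬ (v ≡ 2 × l ≡ 2 × t ≡ 1) →
                         NonZero ((v ℕ.* l ℕ.∸ 1) P (2 ℕ.* t ℕ.+ 2))
  variance-denominator ≢221 = P-nonZero (ℕₚ.∸-monoˡ-≤ 1
    (subst (_≤ v ℕ.* l) (ℕₚ.+-suc (2 ℕ.* t) 2) (variance-bound v l t v≥2 t≥1 n≥2vt ≢221)))

{-# OPTIONS --safe #-}
-- Encode "a run of b of length t starts after position k" by the word
-- miss hitᵗ miss read cyclically from k. The uniform distribution on balanced
-- sequences is invariant under rotation, so E(ρ) = n c(0) and E(ρ²) = n Σ c(d),
-- where c(d) is the probability that the word occurs at 0 and at d. Overlapping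
-- runs are impossible, so c(d) = 0 for 1 ≤ d ≤ t; runs at distance t + 1 share a
-- miss; c(d) = c(n - d); and otherwise the two occurrences are disjoint. Up to a
-- permutation of positions, every pattern that arises prescribes r hits and s
-- misses at the front, and double counting the next position gives its
-- probability (l)_r (n - l)_s / (n)_{r+s}.
module Submission where

open import Defs
open import Data.Nat.Base as ℕ using (ℕ; zero; suc; _≥_; _∸_; _≤_; _<_; s≤s; z≤n; NonZero)
import Data.Nat.DivMod as ℕ
import Data.Nat.Properties as ℕₚ
open import Data.Nat.Combinatorics using (_P_)
open import Data.Nat.Combinatorics.Base using (_P′_)
open import Data.Nat.Tactic.RingSolver using () renaming (solve-∀ to ℕ-solve-∀)
open import Data.Integer.Base as ℤ using (ℤ; +_; 0ℤ; 1ℤ; _+_; _-_; _*_; _^_)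
import Data.Integer.Properties as ℤₚ
open import Data.Integer.Tactic.RingSolver using (solve-∀)
open import Data.Rational.Base as ℚ using (_/_)
import Data.Rational.Properties as ℚₚ
import Data.Rational.Solver as ℚ
open import Data.Rational.Unnormalised.Base as ℚᵘ using (mkℚᵘ; *≡*)
import Data.Rational.Unnormalised.Properties as ℚᵘₚ
open import Data.Bool.Base using (true; false; if_then_else_)
open import Data.Fin.Base using (Fin; zero; suc; toℕ; fromℕ<)
import Data.Fin.Properties as Finₚ
open import Data.List.Base as List using (List; []; _∷_; _++_; length; filter; replicate; allFin; upTo)
import Data.List.Properties as Listₚ
open import Data.List.Relation.Binary.Permutation.Propositional as ↭ using (_↭_; ↭-sym; ↭-trans; prep; swap)
import Data.List.Relation.Binary.Permutation.Propositional.Properties as ↭ₚ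
open import Data.Product.Base using (_×_; _,_)
open import Data.Sum.Base using (inj₁; inj₂)
open import Data.Vec.Base using (Vec; []; _∷_; _∷ʳ_; toList; lookup; count)
import Data.Vec.Properties as Vecₚ
open import Algebra.Bundles using (CommutativeMonoid)
open import Algebra.Properties.AbelianGroup ℤₚ.+-0-abelianGroup using (∙-cancelˡ)
open import Function.Base using (_∘_; id)
open import Relation.Nullary using (Dec; ¬_; does; yes; no; contradiction)
open import Relation.Nullary.Decidable using (¬?; _×-dec_)
open import Relation.Unary using (Decidable)
open import Relation.Binary.PropositionalEquality

private
  variable
    A C : Set
    R S : Set
    v n : ℕ

-- The three terms of the variance come from splitting E(ρ²) as E(ρ) + E(ρ(ρ - 1)): offset 0 yields
-- the mean, and the last term is the expected number of ordered pairs of distinct runs. Pairs that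
-- share a miss and disjoint pairs have probabilities with denominators (n)_{2t+3} and (n)_{2t+4}.
-- There are exactly n - 2t - 3 offsets of the disjoint kind, and this number is the last factor of
-- the larger denominator, so both kinds end up over (n)_{2t+3}; the n starting positions then
-- cancel its leading factor. Counting the offsets in this way requires n ≥ 2t + 4, which is what
-- rules out v = l = 2, t = 1. Division is postponed to the very end: each probability appears as an
-- integer identity multiplied by its denominator, so subtraction is never truncated and the algebra
-- is polynomial. Sums over sequences are iterated letter by letter, so permuting the prescribed
-- positions is an exchange of finite sums and needs no bijection between sets of sequences.

+-congˡ : ∀ (x : ℤ) {y z} → y ≡ z → x + y ≡ x + z
+-congˡ x = cong (ℤ._+_ x)

-- Finite sums and indicators

∑ : List A → (A → ℤ) → ℤ
∑ []       f = 0ℤ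
∑ (x ∷ xs) f = f x + ∑ xs f

∑-cong : (xs : List A) {f g : A → ℤ} → (∀ x → f x ≡ g x) → ∑ xs f ≡ ∑ xs g
∑-cong []       eq = refl
∑-cong (x ∷ xs) eq = cong₂ _+_ (eq x) (∑-cong xs eq)

∑-zero : (xs : List A) → ∑ xs (λ _ → 0ℤ) ≡ 0ℤ
∑-zero []       = refl
∑-zero (x ∷ xs) = trans (ℤₚ.+-identityˡ _) (∑-zero xs)

∑-const : (xs : List A) (c : ℤ) → ∑ xs (λ _ → c) ≡ + length xs * c
∑-const []       c = refl
∑-const (x ∷ xs) c = trans (+-congˡ c (∑-const xs c)) (sym (ℤₚ.suc-* (+ length xs) c))

∑-+ : (xs : List A) (f g : A → ℤ) → ∑ xs (λ x → f x + g x) ≡ ∑ xs f + ∑ xs g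
∑-+ []       f g = refl
∑-+ (x ∷ xs) f g = trans (+-congˡ (f x + g x) (∑-+ xs f g)) (interchange (f x) (g x) (∑ xs f) (∑ xs g))
  where
  interchange : ∀ a b c d → a + b + (c + d) ≡ a + c + (b + d)
  interchange = solve-∀

∑-*ˡ : (xs : List A) (c : ℤ) (f : A → ℤ) → ∑ xs (λ x → c * f x) ≡ c * ∑ xs f
∑-*ˡ []       c f = sym (ℤₚ.*-zeroʳ c)
∑-*ˡ (x ∷ xs) c f = trans (+-congˡ (c * f x) (∑-*ˡ xs c f)) (sym (ℤₚ.*-distribˡ-+ c (f x) (∑ xs f)))

∑-*ʳ : (xs : List A) (c : ℤ) (f : A → ℤ) → ∑ xs (λ x → f x * c) ≡ ∑ xs f * c
∑-*ʳ xs c f = trans (∑-cong xs λ x → ℤₚ.*-comm (f x) c)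
  (trans (∑-*ˡ xs c f) (ℤₚ.*-comm c (∑ xs f)))

∑-comm : (xs : List A) (ys : List C) (f : A → C → ℤ) →
         ∑ xs (λ x → ∑ ys (f x)) ≡ ∑ ys (λ y → ∑ xs (λ x → f x y))
∑-comm []       ys f = sym (∑-zero ys)
∑-comm (x ∷ xs) ys f = trans (+-congˡ (∑ ys (f x)) (∑-comm xs ys f)) (sym (∑-+ ys (f x) _))

∑-++ : (xs ys : List A) (f : A → ℤ) → ∑ (xs ++ ys) f ≡ ∑ xs f + ∑ ys f
∑-++ []       ys f = sym (ℤₚ.+-identityˡ _)
∑-++ (x ∷ xs) ys f = trans (+-congˡ (f x) (∑-++ xs ys f)) (sym (ℤₚ.+-assoc (f x) (∑ xs f) (∑ ys f)))

∑-map : (h : A → C) (xs : List A) (f : C → ℤ) → ∑ (List.map h xs) f ≡ ∑ xs (f ∘ h)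
∑-map h []       f = refl
∑-map h (x ∷ xs) f = +-congˡ (f (h x)) (∑-map h xs f)

∑-upTo-suc : ∀ n (f : ℕ → ℤ) → ∑ (upTo (suc n)) f ≡ f 0 + ∑ (upTo n) (f ∘ suc)
∑-upTo-suc n f = +-congˡ (f 0)
  (trans (cong (λ xs → ∑ xs f) (sym (Listₚ.map-upTo suc n))) (∑-map suc (upTo n) f))

∑-upTo-+ : ∀ m n (f : ℕ → ℤ) →
           ∑ (upTo (m ℕ.+ n)) f ≡ ∑ (upTo m) f + ∑ (upTo n) (λ k → f (m ℕ.+ k))
∑-upTo-+ zero    n f = sym (ℤₚ.+-identityˡ _)
∑-upTo-+ (suc m) n f = begin
  ∑ (upTo (suc m ℕ.+ n)) f
    ≡⟨ ∑-upTo-suc (m ℕ.+ n) f ⟩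
  f 0 + ∑ (upTo (m ℕ.+ n)) (f ∘ suc)
    ≡⟨ +-congˡ (f 0) (∑-upTo-+ m n (f ∘ suc)) ⟩
  f 0 + (∑ (upTo m) (f ∘ suc) + ∑ (upTo n) (λ k → f (suc m ℕ.+ k)))
    ≡⟨ ℤₚ.+-assoc (f 0) _ _ ⟨
  f 0 + ∑ (upTo m) (f ∘ suc) + ∑ (upTo n) (λ k → f (suc m ℕ.+ k))
    ≡⟨ cong (_+ ∑ (upTo n) (λ k → f (suc m ℕ.+ k))) (∑-upTo-suc m f) ⟨
  ∑ (upTo (suc m)) f + ∑ (upTo n) (λ k → f (suc m ℕ.+ k)) ∎
  where open ≡-Reasoning

∑-upTo-cong : ∀ n {f g : ℕ → ℤ} → (∀ k → k < n → f k ≡ g k) → ∑ (upTo n) f ≡ ∑ (upTo n) g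
∑-upTo-cong zero    eq = refl
∑-upTo-cong (suc n) {f} {g} eq = trans (∑-upTo-suc n f) (trans
  (cong₂ _+_ (eq 0 (s≤s z≤n)) (∑-upTo-cong n λ k k<n → eq (suc k) (s≤s k<n)))
  (sym (∑-upTo-suc n g)))

∑-upTo-const : ∀ n {f : ℕ → ℤ} c → (∀ k → k < n → f k ≡ c) → ∑ (upTo n) f ≡ + n * c
∑-upTo-const n c eq = trans (∑-upTo-cong n eq) (trans (∑-const (upTo n) c)
  (cong (λ m → + m * c) (Listₚ.length-upTo n)))

∑-allFin : ∀ n (f : ℕ → ℤ) → ∑ (allFin n) (f ∘ toℕ) ≡ ∑ (upTo n) f
∑-allFin zero    f = refl
∑-allFin (suc n) f = begin
  f 0 + ∑ (List.tabulate {n = n} suc) (f ∘ toℕ)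
    ≡⟨ cong (λ xs → f 0 + ∑ xs (f ∘ toℕ)) (Listₚ.map-tabulate {n = n} id suc) ⟨
  f 0 + ∑ (List.map suc (allFin n)) (f ∘ toℕ)
    ≡⟨ +-congˡ (f 0) (∑-map suc (allFin n) (f ∘ toℕ)) ⟩
  f 0 + ∑ (allFin n) (f ∘ suc ∘ toℕ)
    ≡⟨ +-congˡ (f 0) (∑-allFin n (f ∘ suc)) ⟩
  f 0 + ∑ (upTo n) (f ∘ suc)
    ≡⟨ ∑-upTo-suc n f ⟨
  ∑ (upTo (suc n)) f ∎
  where open ≡-Reasoning

-- The first `m + n` terms are split in two ways, at `m` and at `n`; periodicity identifies the tail
-- of the second splitting with the first `m` terms, which then cancel.
∑-periodic : ∀ n {f : ℕ → ℤ} → (∀ k → f (k ℕ.+ n) ≡ f k) →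
             ∀ m → ∑ (upTo n) (λ k → f (m ℕ.+ k)) ≡ ∑ (upTo n) f
∑-periodic n {f} per m = ∙-cancelˡ (∑ (upTo m) f) _ _ (begin
  ∑ (upTo m) f + ∑ (upTo n) (λ k → f (m ℕ.+ k))
    ≡⟨ ∑-upTo-+ m n f ⟨
  ∑ (upTo (m ℕ.+ n)) f
    ≡⟨ cong (λ j → ∑ (upTo j) f) (ℕₚ.+-comm m n) ⟩
  ∑ (upTo (n ℕ.+ m)) f
    ≡⟨ ∑-upTo-+ n m f ⟩
  ∑ (upTo n) f + ∑ (upTo m) (λ k → f (n ℕ.+ k))
    ≡⟨ +-congˡ (∑ (upTo n) f) (∑-cong (upTo m) λ k → trans (cong f (ℕₚ.+-comm n k)) (per k)) ⟩
  ∑ (upTo n) f + ∑ (upTo m) f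
    ≡⟨ ℤₚ.+-comm (∑ (upTo n) f) _ ⟩
  ∑ (upTo m) f + ∑ (upTo n) f ∎)
  where open ≡-Reasoning

𝟙 : Dec R → ℤ
𝟙 R? = if does R? then 1ℤ else 0ℤ

𝟙-cong : (R? : Dec R) (S? : Dec S) → (R → S) → (S → R) → 𝟙 R? ≡ 𝟙 S?
𝟙-cong (yes p) (yes q) to from = refl
𝟙-cong (yes p) (no ¬q) to from = contradiction (to p) ¬q
𝟙-cong (no ¬p) (yes q) to from = contradiction (from q) ¬p
𝟙-cong (no ¬p) (no ¬q) to from = refl

𝟙-false : (R? : Dec R) → ¬ R → 𝟙 R? ≡ 0ℤ
𝟙-false (yes p) ¬p = contradiction p ¬p
𝟙-false (no _)  _  = refl

𝟙-idem : (R? : Dec R) → 𝟙 R? * 𝟙 R? ≡ 𝟙 R?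
𝟙-idem (yes _) = refl
𝟙-idem (no _)  = refl

𝟙-× : (R? : Dec R) (S? : Dec S) → 𝟙 (R? ×-dec S?) ≡ 𝟙 R? * 𝟙 S?
𝟙-× (yes _) (yes _) = refl
𝟙-× (yes _) (no _)  = refl
𝟙-× (no _)  S?      = refl

∑-filter : {R : A → Set} (R? : Decidable R) (xs : List A) (f : A → ℤ) →
           ∑ (filter R? xs) f ≡ ∑ xs (λ x → 𝟙 (R? x) * f x)
∑-filter R? []       f = refl
∑-filter R? (x ∷ xs) f with does (R? x)
... | true  = cong₂ _+_ (sym (ℤₚ.*-identityˡ (f x))) (∑-filter R? xs f)
... | false = trans (∑-filter R? xs f) (sym (ℤₚ.+-identityˡ _))

length-filter : {R : A → Set} (R? : Decidable R) (xs : List A) →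
                + length (filter R? xs) ≡ ∑ xs (𝟙 ∘ R?)
length-filter R? xs = begin
  + length (filter R? xs)         ≡⟨ ℤₚ.*-identityʳ _ ⟨
  + length (filter R? xs) * 1ℤ    ≡⟨ ∑-const (filter R? xs) 1ℤ ⟨
  ∑ (filter R? xs) (λ _ → 1ℤ)     ≡⟨ ∑-filter R? xs (λ _ → 1ℤ) ⟩
  ∑ xs (λ x → 𝟙 (R? x) * 1ℤ)      ≡⟨ ∑-cong xs (λ x → ℤₚ.*-identityʳ _) ⟩
  ∑ xs (𝟙 ∘ R?)                   ∎
  where open ≡-Reasoning

∑-cartesianProductWith : {D : Set} (h : A → C → D) (xs : List A) (ys : List C) (f : D → ℤ) →
                         ∑ (List.cartesianProductWith h xs ys) f ≡ ∑ xs (λ x → ∑ ys (λ y → f (h x y)))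
∑-cartesianProductWith h []       ys f = refl
∑-cartesianProductWith h (x ∷ xs) ys f = trans (∑-++ (List.map (h x) ys) _ f)
  (cong₂ _+_ (∑-map (h x) ys f) (∑-cartesianProductWith h xs ys f))

-- Falling factorials

-- Integer arguments keep factors such as `+ n - + l - + s` free of truncation. The last factor is
-- split off, as in `_P′_`; `fall-suc` splits off the first.
fall : ℤ → ℕ → ℤ
fall x zero    = 1ℤ
fall x (suc k) = fall x k * (x - + k)

fall-suc : ∀ x k → fall x (suc k) ≡ x * fall (x - 1ℤ) k
fall-suc x zero    = unit x
  where
  unit : ∀ x → 1ℤ * (x - + 0) ≡ x * 1ℤ
  unit = solve-∀
fall-suc x (suc k) = trans (cong (_* (x - + suc k)) (fall-suc x k))
  (shift x (fall (x - 1ℤ) k) (+ k))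
  where
  shift : ∀ x y k → x * y * (x - (1ℤ + k)) ≡ x * (y * (x - 1ℤ - k))
  shift = solve-∀

P≡fall : ∀ {n k} → k ≤ n → + (n P k) ≡ fall (+ n) k
-- `_P_` is guarded by the Boolean test `k ≤ᵇ n`; once it evaluates to `true`, `_P′_` is exposed.
P≡fall {n} {k} k≤n with k ℕ.≤ᵇ n | ℕₚ.≤⇒≤ᵇ k≤n
... | true | _ = P′≡fall k k≤n
  where
  P′≡fall : ∀ k → k ≤ n → + (n P′ k) ≡ fall (+ n) k
  P′≡fall zero    _   = refl
  P′≡fall (suc k) k<n = begin
    + ((n ∸ k) ℕ.* (n P′ k))   ≡⟨ ℤₚ.pos-* (n ∸ k) (n P′ k) ⟩
    + (n ∸ k) * + (n P′ k)     ≡⟨ ℤₚ.*-comm (+ (n ∸ k)) _ ⟩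
    + (n P′ k) * + (n ∸ k)     ≡⟨ cong₂ _*_ (P′≡fall k (ℕₚ.<⇒≤ k<n)) pos-∸ ⟩
    fall (+ n) k * (+ n - + k) ∎
    where
    open ≡-Reasoning
    pos-∸ : + (n ∸ k) ≡ + n - + k
    pos-∸ = sym (trans (ℤₚ.m-n≡m⊖n n k) (ℤₚ.⊖-≥ (ℕₚ.<⇒≤ k<n)))

-- Words of local conditions

data Letter : Set where
  hit miss free : Letter

Word : Set
Word = List Letter

Symmetric : (List A → ℤ) → Set
Symmetric g = ∀ {xs ys} → xs ↭ ys → g xs ≡ g ys

occurrences : Fin v → List (Fin v) → ℕ
occurrences c xs = length (filter (Finₚ._≟ c) xs)

module _ {v : ℕ} (b : Fin v) where

  weight : Letter → Fin v → ℤ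
  weight hit  c = 𝟙 (c Finₚ.≟ b)
  weight miss c = 𝟙 (¬? (c Finₚ.≟ b))
  weight free c = 1ℤ

  weight-free : ∀ c → weight free c ≡ weight hit c + weight miss c
  weight-free c with c Finₚ.≟ b
  ... | yes _ = refl
  ... | no  _ = refl

  hit-miss : ∀ c → weight hit c * weight miss c ≡ 0ℤ
  hit-miss c with c Finₚ.≟ b
  ... | yes _ = refl
  ... | no  _ = refl

  weight-idem : ∀ p c → weight p c * weight p c ≡ weight p c
  weight-idem hit  c = 𝟙-idem (c Finₚ.≟ b)
  weight-idem miss c = 𝟙-idem (¬? (c Finₚ.≟ b))
  weight-idem free c = refl

  -- The total of `g` over all lists that fit `w`, in the form of an iterated sum: neighbouring
  -- letters of `w` correspond to neighbouring summation signs. `∑-matchVec` links it to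
  -- `sequences`.
  weightedSum : Word → (List (Fin v) → ℤ) → ℤ
  weightedSum []      g = g []
  weightedSum (p ∷ w) g = ∑ (allFin v) λ c → weight p c * weightedSum w (g ∘ (c ∷_))

  -- A transposition of neighbouring letters exchanges two finite sums, and the symmetry of `g`
  -- undoes the exchange of the two entries in its argument.
  weightedSum-↭ : ∀ {w w′ g} → Symmetric g → w ↭ w′ → weightedSum w g ≡ weightedSum w′ g
  weightedSum-↭ sym-g ↭.refl = refl
  weightedSum-↭ sym-g (prep p w↭w′) =
    ∑-cong (allFin v) λ c → cong (weight p c *_) (weightedSum-↭ (sym-g ∘ prep c) w↭w′)
  weightedSum-↭ {p ∷ q ∷ w} {.q ∷ .p ∷ w′} {g} sym-g (swap .p .q w↭w′) = begin
    ∑ (allFin v) (λ c → weight p c * ∑ (allFin v) (λ d → weight q d * G c d))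
      ≡⟨ ∑-cong (allFin v) (λ c → ∑-*ˡ (allFin v) (weight p c) _) ⟨
    ∑ (allFin v) (λ c → ∑ (allFin v) (λ d → weight p c * (weight q d * G c d)))
      ≡⟨ ∑-comm (allFin v) (allFin v) _ ⟩
    ∑ (allFin v) (λ d → ∑ (allFin v) (λ c → weight p c * (weight q d * G c d)))
      ≡⟨ ∑-cong (allFin v) (λ d → ∑-cong (allFin v) λ c → trans
           (exchange (weight p c) (weight q d) (G c d))
           (cong (λ x → weight q d * (weight p c * x))
             (trans (weightedSum-↭ (sym-g ∘ prep c ∘ prep d) w↭w′)
                    (weightedSum-cong w′ λ xs → sym-g (swap c d ↭.refl))))) ⟩
    ∑ (allFin v) (λ d → ∑ (allFin v) (λ c → weight q d * (weight p c * G′ d c)))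
      ≡⟨ ∑-cong (allFin v) (λ d → ∑-*ˡ (allFin v) (weight q d) _) ⟩
    ∑ (allFin v) (λ d → weight q d * ∑ (allFin v) (λ c → weight p c * G′ d c)) ∎
    where
    open ≡-Reasoning
    G G′ : Fin v → Fin v → ℤ
    G  c d = weightedSum w  (g ∘ (c ∷_) ∘ (d ∷_))
    G′ d c = weightedSum w′ (g ∘ (d ∷_) ∘ (c ∷_))
    exchange : ∀ x y z → x * (y * z) ≡ y * (x * z)
    exchange = solve-∀
    weightedSum-cong : ∀ w {g h} → (∀ xs → g xs ≡ h xs) → weightedSum w g ≡ weightedSum w h
    weightedSum-cong []      g≗h = g≗h []
    weightedSum-cong (p ∷ w) g≗h =
      ∑-cong (allFin v) λ c → cong (weight p c *_) (weightedSum-cong w (g≗h ∘ (c ∷_)))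
  weightedSum-↭ sym-g (↭.trans w↭w′ w′↭w″) =
    trans (weightedSum-↭ sym-g w↭w′) (weightedSum-↭ sym-g w′↭w″)

  weightedSum-free : ∀ w g →
    weightedSum (free ∷ w) g ≡ weightedSum (hit ∷ w) g + weightedSum (miss ∷ w) g
  weightedSum-free w g = trans
    (∑-cong (allFin v) λ c → trans
      (cong (_* weightedSum w (g ∘ (c ∷_))) (weight-free c))
      (ℤₚ.*-distribʳ-+ (weightedSum w (g ∘ (c ∷_))) (weight hit c) (weight miss c)))
    (∑-+ (allFin v) _ _)

  -- Without free letters a fitting list contains `b` exactly `r` times, so only such lists
  -- contribute to the sum.
  weightedSum-vanish : ∀ r s {g} → (∀ xs → occurrences b xs ≡ r → g xs ≡ 0ℤ) →
    weightedSum (replicate r hit ++ replicate s miss) g ≡ 0ℤ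
  weightedSum-vanish zero    zero    g≡0 = g≡0 [] refl
  weightedSum-vanish zero    (suc s) {g} g≡0 =
    trans (∑-cong (allFin v) term) (∑-zero (allFin v))
    where
    term : ∀ c → weight miss c * weightedSum (replicate s miss) (g ∘ (c ∷_)) ≡ 0ℤ
    term c with c Finₚ.≟ b in eq
    ... | yes _ = refl
    ... | no c≢b = trans (ℤₚ.*-identityˡ _) (weightedSum-vanish zero s λ xs occ →
      g≡0 (c ∷ xs) (trans (cong length (Listₚ.filter-reject (Finₚ._≟ b) c≢b)) occ))
  weightedSum-vanish (suc r) s {g} g≡0 =
    trans (∑-cong (allFin v) term) (∑-zero (allFin v))
    where
    term : ∀ c → weight hit c * weightedSum (replicate r hit ++ replicate s miss) (g ∘ (c ∷_)) ≡ 0ℤ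
    term c with c Finₚ.≟ b
    ... | yes c≡b = trans (ℤₚ.*-identityˡ _) (weightedSum-vanish r s λ xs occ →
      g≡0 (c ∷ xs) (trans (cong length (Listₚ.filter-accept (Finₚ._≟ b) c≡b)) (cong suc occ)))
    ... | no _ = refl

  matchVec : (w : Word) → Vec (Fin v) (length w) → ℤ
  matchVec []      []      = 1ℤ
  matchVec (p ∷ w) (c ∷ σ) = weight p c * matchVec w σ

  ∑-matchVec : ∀ w (g : List (Fin v) → ℤ) →
    ∑ (sequences v (length w)) (λ σ → g (toList σ) * matchVec w σ) ≡ weightedSum w g
  ∑-matchVec []      g = trans (ℤₚ.+-identityʳ _) (ℤₚ.*-identityʳ _)
  ∑-matchVec (p ∷ w) g = begin
    ∑ (sequences v (suc (length w))) (λ σ → g (toList σ) * matchVec (p ∷ w) σ)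
      ≡⟨ ∑-cartesianProductWith _∷_ (allFin v) (sequences v (length w)) _ ⟩
    ∑ (allFin v) (λ c → ∑ (sequences v (length w)) λ σ → g (c ∷ toList σ) * (weight p c * matchVec w σ))
      ≡⟨ ∑-cong (allFin v) (λ c → trans
           (∑-cong (sequences v (length w)) λ σ → exchange (g (c ∷ toList σ)) (weight p c) (matchVec w σ))
           (trans (∑-*ˡ (sequences v (length w)) (weight p c) _)
                  (cong (weight p c *_) (∑-matchVec w (g ∘ (c ∷_)))))) ⟩
    ∑ (allFin v) (λ c → weight p c * weightedSum w (g ∘ (c ∷_))) ∎
    where
    open ≡-Reasoning
    exchange : ∀ x y z → x * (y * z) ≡ y * (x * z)
    exchange = solve-∀

  -- Reading from a function on ℕ, and not from a vector, lets a word start at any offset and wrap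
  -- around a cyclic sequence.
  match : Word → (ℕ → Fin v) → ℤ
  match []      s = 1ℤ
  match (p ∷ w) s = weight p (s 0) * match w (s ∘ suc)

  match-cong : ∀ w {s s′} → (∀ k → s k ≡ s′ k) → match w s ≡ match w s′
  match-cong []      eq = refl
  match-cong (p ∷ w) eq = cong₂ (λ c → weight p c *_) (eq 0) (match-cong w (eq ∘ suc))

  match-++ : ∀ w w′ s → match (w ++ w′) s ≡ match w s * match w′ (λ k → s (length w ℕ.+ k))
  match-++ []      w′ s = sym (ℤₚ.*-identityˡ _)
  match-++ (p ∷ w) w′ s = trans (cong (weight p (s 0) *_) (match-++ w w′ (s ∘ suc)))
    (sym (ℤₚ.*-assoc (weight p (s 0)) _ _))

  match-free : ∀ m s → match (replicate m free) s ≡ 1ℤ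
  match-free zero    s = refl
  match-free (suc m) s = trans (ℤₚ.*-identityˡ _) (match-free m (s ∘ suc))

  match-idem : ∀ w s → match w s * match w s ≡ match w s
  match-idem []      s = refl
  match-idem (p ∷ w) s = trans
    (interchange (weight p (s 0)) (match w (s ∘ suc)))
    (cong₂ _*_ (weight-idem p (s 0)) (match-idem w (s ∘ suc)))
    where
    interchange : ∀ x y → x * y * (x * y) ≡ x * x * (y * y)
    interchange = solve-∀

  match≡matchVec : ∀ w {s} (σ : Vec (Fin v) (length w)) → (∀ i → s (toℕ i) ≡ lookup σ i) →
                   match w s ≡ matchVec w σ
  match≡matchVec []      []      eq = refl
  match≡matchVec (p ∷ w) (c ∷ σ) eq =
    cong₂ (λ c → weight p c *_) (eq zero) (match≡matchVec w σ (eq ∘ suc))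

-- Balance of lists and its invariance under permutation

BalancedList : ℕ → List (Fin v) → Set
BalancedList l xs = ∀ c → occurrences c xs ≡ l

balancedList? : ∀ l (xs : List (Fin v)) → Dec (BalancedList l xs)
balancedList? l xs = Finₚ.all? λ c → occurrences c xs ℕₚ.≟ l

occurrences-↭ : ∀ (c : Fin v) {xs ys} → xs ↭ ys → occurrences c xs ≡ occurrences c ys
occurrences-↭ c = ↭ₚ.↭-length ∘ ↭ₚ.filter-↭ (Finₚ._≟ c)

balanced-symmetric : ∀ l → Symmetric {Fin v} (𝟙 ∘ balancedList? l)
balanced-symmetric l {xs} {ys} xs↭ys = 𝟙-cong (balancedList? l xs) (balancedList? l ys)
  (λ bal c → trans (sym (occurrences-↭ c xs↭ys)) (bal c))
  (λ bal c → trans (occurrences-↭ c xs↭ys) (bal c))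

count-toList : ∀ (c : Fin v) (σ : Vec (Fin v) n) → count (Finₚ._≟ c) σ ≡ occurrences c (toList σ)
count-toList c []      = refl
count-toList c (x ∷ σ) with does (x Finₚ.≟ c)
... | true  = cong suc (count-toList c σ)
... | false = count-toList c σ

balanced-toList : ∀ l (σ : Vec (Fin v) n) → 𝟙 (balanced? l σ) ≡ 𝟙 (balancedList? l (toList σ))
balanced-toList l σ = 𝟙-cong (balanced? l σ) (balancedList? l (toList σ))
  (λ bal c → trans (sym (count-toList c σ)) (bal c))
  (λ bal c → trans (count-toList c σ) (bal c))

balanced : ∀ v l n → List (Vec (Fin v) n)
balanced v l n = filter (balanced? l) (sequences v n)

-- Counting balanced sequences with prescribed hits and misses

sortedWord : ℕ → ℕ → ℕ → Word
sortedWord r s m = replicate r hit ++ replicate s miss ++ replicate m free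

module _ {v : ℕ} (b : Fin v) (l : ℕ) where

  -- By `weightedSum-↭` this is the count for every word with `r` hits, `s` misses and `m` free
  -- letters, in whatever order they come.
  sorted : ℕ → ℕ → ℕ → ℤ
  sorted r s m = weightedSum b (sortedWord r s m) (𝟙 ∘ balancedList? l)

  -- One free letter is brought to the front and resolved into a hit or a miss; the miss is then
  -- moved back behind the hits.
  sorted-step : ∀ r s m → sorted r s (suc m) ≡ sorted (suc r) s m + sorted r (suc s) m
  sorted-step r s m = begin
    sorted r s (suc m)
      ≡⟨ weightedSum-↭ b (balanced-symmetric l) (↭-trans
           (↭ₚ.++⁺ˡ (replicate r hit) (↭ₚ.shift free (replicate s miss) (replicate m free)))
           (↭ₚ.shift free (replicate r hit) (replicate s miss ++ replicate m free))) ⟩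
    weightedSum b (free ∷ sortedWord r s m) (𝟙 ∘ balancedList? l)
      ≡⟨ weightedSum-free b (sortedWord r s m) (𝟙 ∘ balancedList? l) ⟩
    sorted (suc r) s m + weightedSum b (miss ∷ sortedWord r s m) (𝟙 ∘ balancedList? l)
      ≡⟨ +-congˡ (sorted (suc r) s m) (weightedSum-↭ b (balanced-symmetric l)
           (↭-sym (↭ₚ.shift miss (replicate r hit) (replicate s miss ++ replicate m free)))) ⟩
    sorted (suc r) s m + sorted r (suc s) m ∎
    where
    open ≡-Reasoning

  -- When every position is prescribed, `b` occurs exactly `r` times, so the count can be nonzero
  -- only if `r` is `l`. This starts the induction in `sorted-hit`.
  sorted-full : ∀ r s → (+ l - + r) * sorted r s 0 ≡ 0ℤ
  sorted-full r s with r ℕₚ.≟ l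
  ... | yes refl = cong (_* sorted r s 0) (ℤₚ.+-inverseʳ (+ l))
  ... | no  r≢l  = trans (cong ((+ l - + r) *_) (trans
    (cong (λ w → weightedSum b (replicate r hit ++ w) (𝟙 ∘ balancedList? l)) (Listₚ.++-identityʳ _))
    (weightedSum-vanish b r s λ xs occ → 𝟙-false (balancedList? l xs) λ bal →
      r≢l (trans (sym occ) (bal b))))) (ℤₚ.*-zeroʳ (+ l - + r))

  -- Double counting of the pairs consisting of a sequence and a free position
  -- that holds b, proved here by induction on the number of free positions.
  sorted-hit : ∀ m r s → + suc m * sorted (suc r) s m ≡ (+ l - + r) * sorted r s (suc m)
  sorted-hit m r s = begin
    + suc m * sorted (suc r) s m
      ≡⟨ ℤₚ.suc-* (+ m) (sorted (suc r) s m) ⟩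
    sorted (suc r) s m + + m * sorted (suc r) s m
      ≡⟨ +-congˡ (sorted (suc r) s m) (rest m) ⟩
    sorted (suc r) s m + ((+ l - + suc r) * sorted (suc r) s m + (+ l - + r) * sorted r (suc s) m)
      ≡⟨ collect (+ l) (+ r) (sorted (suc r) s m) (sorted r (suc s) m) ⟩
    (+ l - + r) * (sorted (suc r) s m + sorted r (suc s) m)
      ≡⟨ cong ((+ l - + r) *_) (sorted-step r s m) ⟨
    (+ l - + r) * sorted r s (suc m) ∎
    where
    open ≡-Reasoning
    collect : ∀ l r x y → x + ((l - (1ℤ + r)) * x + (l - r) * y) ≡ (l - r) * (x + y)
    collect = solve-∀
    rest : ∀ m → + m * sorted (suc r) s m ≡
                 (+ l - + suc r) * sorted (suc r) s m + (+ l - + r) * sorted r (suc s) m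
    rest zero    = sym (cong₂ _+_ (sorted-full (suc r) s) (sorted-full r (suc s)))
    rest (suc m) = begin
      + suc m * sorted (suc r) s (suc m)
        ≡⟨ cong (+ suc m *_) (sorted-step (suc r) s m) ⟩
      + suc m * (sorted (suc (suc r)) s m + sorted (suc r) (suc s) m)
        ≡⟨ ℤₚ.*-distribˡ-+ (+ suc m) (sorted (suc (suc r)) s m) (sorted (suc r) (suc s) m) ⟩
      + suc m * sorted (suc (suc r)) s m + + suc m * sorted (suc r) (suc s) m
        ≡⟨ cong₂ _+_ (sorted-hit m (suc r) s) (sorted-hit m r (suc s)) ⟩
      (+ l - + suc r) * sorted (suc r) s (suc m) + (+ l - + r) * sorted r (suc s) (suc m) ∎

  -- A free position holds `b` or does not, so `sorted-hit` is subtracted from `+ suc m` times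
  -- `sorted-step`. Since `r ℕ.+ s ℕ.+ suc m` is the full length n, the factor n - l - s counts the
  -- entries different from `b` that are not yet placed.
  sorted-miss : ∀ m r s → + suc m * sorted r (suc s) m ≡
                          (+ (r ℕ.+ s ℕ.+ suc m) - + l - + s) * sorted r s (suc m)
  sorted-miss m r s = begin
    + suc m * sorted r (suc s) m
      ≡⟨ expand (+ suc m) (sorted (suc r) s m) (sorted r (suc s) m) ⟩
    + suc m * (sorted (suc r) s m + sorted r (suc s) m) - + suc m * sorted (suc r) s m
      ≡⟨ cong₂ (λ x y → + suc m * x - y) (sym (sorted-step r s m)) (sorted-hit m r s) ⟩
    + suc m * sorted r s (suc m) - (+ l - + r) * sorted r s (suc m)
      ≡⟨ collect (+ suc m) (+ l) (+ r) (+ s) (sorted r s (suc m)) ⟩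
    (+ (r ℕ.+ s ℕ.+ suc m) - + l - + s) * sorted r s (suc m) ∎
    where
    open ≡-Reasoning
    expand : ∀ k x y → k * y ≡ k * (x + y) - k * x
    expand = solve-∀
    collect : ∀ k l r s x → k * x - (l - r) * x ≡ (r + s + k - l - s) * x
    collect = solve-∀

  -- The probability (l)_r (n - l)_s / (n)_{r+s}, multiplied out. Prescribed positions are released
  -- one at a time, the misses before the hits, and each release contributes one factor to both
  -- sides.
  sorted-fall : ∀ r s m {n} → r ℕ.+ s ℕ.+ m ≡ n →
    sorted r s m * fall (+ n) (r ℕ.+ s) ≡ fall (+ l) r * fall (+ n - + l) s * sorted 0 0 n
  sorted-fall zero    zero    m refl = swap-units (sorted 0 0 m)
    where
    swap-units : ∀ x → x * 1ℤ ≡ 1ℤ * 1ℤ * x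
    swap-units = solve-∀
  sorted-fall (suc r) zero    m {n} refl = begin
    sorted (suc r) 0 m * fall (+ n) (suc r ℕ.+ 0)
      ≡⟨ cong (λ x → sorted (suc r) 0 m * (fall (+ n) (r ℕ.+ 0) * (+ x - + (r ℕ.+ 0)))) n≡ ⟨
    sorted (suc r) 0 m * (fall (+ n) (r ℕ.+ 0) * (+ (r ℕ.+ 0) + + suc m - + (r ℕ.+ 0)))
      ≡⟨ regroup (sorted (suc r) 0 m) (fall (+ n) (r ℕ.+ 0)) (+ (r ℕ.+ 0)) (+ suc m) ⟩
    + suc m * sorted (suc r) 0 m * fall (+ n) (r ℕ.+ 0)
      ≡⟨ cong (_* fall (+ n) (r ℕ.+ 0)) (sorted-hit m r 0) ⟩
    (+ l - + r) * sorted r 0 (suc m) * fall (+ n) (r ℕ.+ 0)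
      ≡⟨ ℤₚ.*-assoc (+ l - + r) _ _ ⟩
    (+ l - + r) * (sorted r 0 (suc m) * fall (+ n) (r ℕ.+ 0))
      ≡⟨ cong ((+ l - + r) *_) (sorted-fall r 0 (suc m) n≡) ⟩
    (+ l - + r) * (fall (+ l) r * 1ℤ * sorted 0 0 n)
      ≡⟨ rotate (+ l - + r) (fall (+ l) r) (sorted 0 0 n) ⟩
    fall (+ l) r * (+ l - + r) * 1ℤ * sorted 0 0 n ∎
    where
    open ≡-Reasoning
    n≡ : r ℕ.+ 0 ℕ.+ suc m ≡ n
    n≡ = ℕₚ.+-suc (r ℕ.+ 0) m
    regroup : ∀ x f r k → x * (f * (r + k - r)) ≡ k * x * f
    regroup = solve-∀
    rotate : ∀ d f x → d * (f * 1ℤ * x) ≡ f * d * 1ℤ * x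
    rotate = solve-∀
  sorted-fall r (suc s) m {n} refl = begin
    sorted r (suc s) m * fall (+ n) (r ℕ.+ suc s)
      ≡⟨ cong (λ k → sorted r (suc s) m * fall (+ n) k) (ℕₚ.+-suc r s) ⟩
    sorted r (suc s) m * (fall (+ n) (r ℕ.+ s) * (+ n - + (r ℕ.+ s)))
      -- The last factor n - (r + s) equals `suc m`, the number of free positions once the last miss
      -- is released; this is the multiplier that `sorted-miss` expects.
      ≡⟨ cong (λ x → sorted r (suc s) m * (fall (+ n) (r ℕ.+ s) * (+ x - + (r ℕ.+ s)))) n≡ ⟨
    sorted r (suc s) m * (fall (+ n) (r ℕ.+ s) * (+ (r ℕ.+ s) + + suc m - + (r ℕ.+ s)))
      ≡⟨ regroup (sorted r (suc s) m) (fall (+ n) (r ℕ.+ s)) (+ (r ℕ.+ s)) (+ suc m) ⟩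
    + suc m * sorted r (suc s) m * fall (+ n) (r ℕ.+ s)
      ≡⟨ cong (_* fall (+ n) (r ℕ.+ s)) (sorted-miss m r s) ⟩
    (+ (r ℕ.+ s ℕ.+ suc m) - + l - + s) * sorted r s (suc m) * fall (+ n) (r ℕ.+ s)
      ≡⟨ cong (λ x → (+ x - + l - + s) * sorted r s (suc m) * fall (+ n) (r ℕ.+ s)) n≡ ⟩
    (+ n - + l - + s) * sorted r s (suc m) * fall (+ n) (r ℕ.+ s)
      ≡⟨ ℤₚ.*-assoc (+ n - + l - + s) _ _ ⟩
    (+ n - + l - + s) * (sorted r s (suc m) * fall (+ n) (r ℕ.+ s))
      ≡⟨ cong ((+ n - + l - + s) *_) (sorted-fall r s (suc m) n≡) ⟩
    (+ n - + l - + s) * (fall (+ l) r * fall (+ n - + l) s * sorted 0 0 n)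
      ≡⟨ rotate (+ n - + l - + s) (fall (+ l) r) (fall (+ n - + l) s) (sorted 0 0 n) ⟩
    fall (+ l) r * (fall (+ n - + l) s * (+ n - + l - + s)) * sorted 0 0 n ∎
    where
    open ≡-Reasoning
    n≡ : r ℕ.+ s ℕ.+ suc m ≡ n
    n≡ = trans (ℕₚ.+-suc (r ℕ.+ s) m) (cong (ℕ._+ m) (sym (ℕₚ.+-suc r s)))
    regroup : ∀ x f r k → x * (f * (r + k - r)) ≡ k * x * f
    regroup = solve-∀
    rotate : ∀ d f g x → d * (f * g * x) ≡ f * (g * d) * x
    rotate = solve-∀

-- Rotations

-- Among the indices read by `ρ`, only i - 1 at i = 0 is negative, so natural indices suffice
-- everywhere else.
at : Vec A n → .{{NonZero n}} → ℕ → A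
at σ k = σ ⟨ + k ⟩

at-% : (σ : Vec A n) .{{_ : NonZero n}} (j k : ℕ) → j ℕ.% n ≡ k ℕ.% n → at σ j ≡ at σ k
at-% {n = n} σ j k eq = cong (lookup σ) (Finₚ.fromℕ<-cong (j ℕ.% n) (k ℕ.% n) eq (ℕ.m%n<n j n) (ℕ.m%n<n k n))

at-periodic : (σ : Vec A n) .{{_ : NonZero n}} (k : ℕ) → at σ (k ℕ.+ n) ≡ at σ k
at-periodic {n = n} σ k = at-% σ (k ℕ.+ n) k (ℕ.[m+n]%n≡m%n k n)

at-toℕ : (σ : Vec A n) .{{_ : NonZero n}} (i : Fin n) → at σ (toℕ i) ≡ lookup σ i
at-toℕ {n = n} σ i = cong (lookup σ) (trans
  (Finₚ.fromℕ<-cong _ _ (ℕ.m<n⇒m%n≡m (Finₚ.toℕ<n i)) (ℕ.m%n<n (toℕ i) n) (Finₚ.toℕ<n i))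
  (Finₚ.fromℕ<-toℕ i (Finₚ.toℕ<n i)))

rotate : Vec A (suc n) → Vec A (suc n)
rotate (x ∷ xs) = xs ∷ʳ x

lookup-∷ʳ-< : (xs : Vec A n) (x : A) {k : ℕ} .(k<1+n : k < suc n) .(k<n : k < n) →
              lookup (xs ∷ʳ x) (fromℕ< k<1+n) ≡ lookup xs (fromℕ< k<n)
lookup-∷ʳ-< (y ∷ xs) x {zero}  _ _ = refl
lookup-∷ʳ-< (y ∷ xs) x {suc k} p q = lookup-∷ʳ-< xs x (ℕ.s<s⁻¹ p) (ℕ.s<s⁻¹ q)

lookup-∷ʳ-last : (xs : Vec A n) (x : A) .(n<1+n : n < suc n) → lookup (xs ∷ʳ x) (fromℕ< n<1+n) ≡ x
lookup-∷ʳ-last []       x _ = refl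
lookup-∷ʳ-last (y ∷ xs) x p = lookup-∷ʳ-last xs x (ℕ.s<s⁻¹ p)

-- If `k` has remainder below `n`, then `suc k` has the next remainder and both sides read the same
-- entry of the tail. If the remainder is `n`, then `suc k` wraps to 0 and both sides read the head,
-- which the rotation has moved to the end.
at-rotate : (σ : Vec A (suc n)) (k : ℕ) → at (rotate σ) k ≡ at σ (suc k)
at-rotate {n = n} (x ∷ xs) k with k ℕ.% suc n in r≡ | ℕ.m%n<n k (suc n)
... | r | r<1+n with ℕₚ.m≤n⇒m<n∨m≡n (ℕ.s≤s⁻¹ r<1+n)
...   | inj₁ r<n = trans (lookup-∷ʳ-< xs x r<1+n r<n)
  (sym (cong (lookup (x ∷ xs)) (Finₚ.fromℕ<-cong _ _ suc-% (ℕ.m%n<n (suc k) (suc n)) (s≤s r<n))))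
  where
  suc-% : suc k ℕ.% suc n ≡ suc r
  suc-% = begin
    suc k ℕ.% suc n
      ≡⟨ cong (λ m → suc m ℕ.% suc n) (ℕ.m≡m%n+[m/n]*n k (suc n)) ⟩
    suc (k ℕ.% suc n ℕ.+ k ℕ./ suc n ℕ.* suc n) ℕ.% suc n
      ≡⟨ ℕ.[m+kn]%n≡m%n (suc (k ℕ.% suc n)) (k ℕ./ suc n) (suc n) ⟩
    suc (k ℕ.% suc n) ℕ.% suc n
      ≡⟨ cong (λ m → suc m ℕ.% suc n) r≡ ⟩
    suc r ℕ.% suc n
      ≡⟨ ℕ.m<n⇒m%n≡m (s≤s r<n) ⟩
    suc r ∎
    where open ≡-Reasoning
...   | inj₂ refl = trans (lookup-∷ʳ-last xs x r<1+n)
  (sym (cong (lookup (x ∷ xs)) (Finₚ.fromℕ<-cong _ 0 suc-% (ℕ.m%n<n (suc k) (suc n)) (s≤s z≤n))))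
  where
  suc-% : suc k ℕ.% suc n ≡ 0
  suc-% = begin
    suc k ℕ.% suc n
      ≡⟨ cong (λ m → suc m ℕ.% suc n) (ℕ.m≡m%n+[m/n]*n k (suc n)) ⟩
    suc (k ℕ.% suc n ℕ.+ k ℕ./ suc n ℕ.* suc n) ℕ.% suc n
      ≡⟨ ℕ.[m+kn]%n≡m%n (suc (k ℕ.% suc n)) (k ℕ./ suc n) (suc n) ⟩
    suc (k ℕ.% suc n) ℕ.% suc n
      ≡⟨ cong (λ m → suc m ℕ.% suc n) r≡ ⟩
    suc n ℕ.% suc n
      ≡⟨ ℕ.n%n≡0 (suc n) ⟩
    0 ∎
    where open ≡-Reasoning

-- Enumeration by the last entry instead of the first. Enumerating by the first entry and then
-- rotating gives the same double sum, whence the rotation invariance below.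
∑-sequences-∷ʳ : ∀ n (f : Vec (Fin v) (suc n) → ℤ) →
  ∑ (sequences v (suc n)) f ≡ ∑ (allFin v) λ c → ∑ (sequences v n) λ τ → f (τ ∷ʳ c)
∑-sequences-∷ʳ {v} zero    f = ∑-cartesianProductWith _∷_ (allFin v) (sequences v 0) f
∑-sequences-∷ʳ {v} (suc n) f = begin
  ∑ (sequences v (suc (suc n))) f
    ≡⟨ ∑-cartesianProductWith _∷_ (allFin v) (sequences v (suc n)) f ⟩
  ∑ (allFin v) (λ d → ∑ (sequences v (suc n)) (f ∘ (d ∷_)))
    ≡⟨ ∑-cong (allFin v) (λ d → ∑-sequences-∷ʳ n (f ∘ (d ∷_))) ⟩
  ∑ (allFin v) (λ d → ∑ (allFin v) λ c → ∑ (sequences v n) λ τ → f (d ∷ (τ ∷ʳ c)))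
    ≡⟨ ∑-comm (allFin v) (allFin v) _ ⟩
  ∑ (allFin v) (λ c → ∑ (allFin v) λ d → ∑ (sequences v n) λ τ → f (d ∷ (τ ∷ʳ c)))
    ≡⟨ ∑-cong (allFin v) (λ c → ∑-cartesianProductWith _∷_ (allFin v) (sequences v n) (f ∘ (_∷ʳ c))) ⟨
  ∑ (allFin v) (λ c → ∑ (sequences v (suc n)) λ τ → f (τ ∷ʳ c)) ∎
  where open ≡-Reasoning

∑-sequences-rotate : ∀ n (f : Vec (Fin v) (suc n) → ℤ) →
  ∑ (sequences v (suc n)) (f ∘ rotate) ≡ ∑ (sequences v (suc n)) f
∑-sequences-rotate {v} n f = trans
  (∑-cartesianProductWith _∷_ (allFin v) (sequences v n) (f ∘ rotate))
  (sym (∑-sequences-∷ʳ n f))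

∑-balanced-rotate : ∀ l n (f : Vec (Fin v) (suc n) → ℤ) →
  ∑ (balanced v l (suc n)) (f ∘ rotate) ≡ ∑ (balanced v l (suc n)) f
∑-balanced-rotate {v} l n f = begin
  ∑ (balanced v l (suc n)) (f ∘ rotate)
    ≡⟨ ∑-filter (balanced? l) (sequences v (suc n)) (f ∘ rotate) ⟩
  ∑ (sequences v (suc n)) (λ σ → 𝟙 (balanced? l σ) * f (rotate σ))
    ≡⟨ ∑-cong (sequences v (suc n)) (λ σ → cong (_* f (rotate σ)) (balanced-rotate σ)) ⟩
  ∑ (sequences v (suc n)) (λ σ → 𝟙 (balanced? l (rotate σ)) * f (rotate σ))
    ≡⟨ ∑-sequences-rotate n (λ σ → 𝟙 (balanced? l σ) * f σ) ⟩
  ∑ (sequences v (suc n)) (λ σ → 𝟙 (balanced? l σ) * f σ)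
    ≡⟨ ∑-filter (balanced? l) (sequences v (suc n)) f ⟨
  ∑ (balanced v l (suc n)) f ∎
  where
  open ≡-Reasoning
  balanced-rotate : ∀ σ → 𝟙 (balanced? l σ) ≡ 𝟙 (balanced? l (rotate σ))
  balanced-rotate (c ∷ τ) = begin
    𝟙 (balanced? l (c ∷ τ))                    ≡⟨ balanced-toList l (c ∷ τ) ⟩
    𝟙 (balancedList? l (c ∷ toList τ))         ≡⟨ balanced-symmetric l (↭ₚ.∷↭∷ʳ c (toList τ)) ⟩
    𝟙 (balancedList? l (toList τ List.∷ʳ c))   ≡⟨ cong (𝟙 ∘ balancedList? l) (Vecₚ.toList-∷ʳ c τ) ⟨
    𝟙 (balancedList? l (toList (τ ∷ʳ c)))      ≡⟨ balanced-toList l (τ ∷ʳ c) ⟨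
    𝟙 (balanced? l (τ ∷ʳ c))                   ∎

-- `F` acts on functions that are known to agree only pointwise; the congruence hypothesis stands in
-- for function extensionality.
∑-balanced-shift : ∀ l n .{{_ : NonZero n}} (F : (ℕ → Fin v) → ℤ) →
  (∀ {s s′} → (∀ j → s j ≡ s′ j) → F s ≡ F s′) → ∀ k →
  ∑ (balanced v l n) (λ σ → F (λ j → at σ (k ℕ.+ j))) ≡ ∑ (balanced v l n) (λ σ → F (at σ))
∑-balanced-shift l (suc n) F F-cong zero    = refl
∑-balanced-shift {v} l (suc n) F F-cong (suc k) = begin
  ∑ (balanced v l (suc n)) (λ σ → F (λ j → at σ (suc (k ℕ.+ j))))
    ≡⟨ ∑-cong (balanced v l (suc n)) (λ σ → F-cong λ j → at-rotate σ (k ℕ.+ j)) ⟨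
  ∑ (balanced v l (suc n)) (λ σ → F (λ j → at (rotate σ) (k ℕ.+ j)))
    ≡⟨ ∑-balanced-rotate l n (λ σ → F (λ j → at σ (k ℕ.+ j))) ⟩
  ∑ (balanced v l (suc n)) (λ σ → F (λ j → at σ (k ℕ.+ j)))
    ≡⟨ ∑-balanced-shift l (suc n) F F-cong k ⟩
  ∑ (balanced v l (suc n)) (λ σ → F (at σ)) ∎
  where open ≡-Reasoning

-- Frequency of a word

module _ {v : ℕ} (b : Fin v) (l : ℕ) where

  ∑-balanced-match : ∀ w n .{{_ : NonZero n}} → length w ≡ n →
    ∑ (balanced v l n) (λ σ → match b w (at σ)) ≡ weightedSum b w (𝟙 ∘ balancedList? l)
  ∑-balanced-match w n refl = begin
    ∑ (balanced v l n) (λ σ → match b w (at σ))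
      ≡⟨ ∑-filter (balanced? l) (sequences v n) _ ⟩
    ∑ (sequences v n) (λ σ → 𝟙 (balanced? l σ) * match b w (at σ))
      ≡⟨ ∑-cong (sequences v n) (λ σ →
           cong₂ _*_ (balanced-toList l σ) (match≡matchVec b w σ (at-toℕ σ))) ⟩
    ∑ (sequences v n) (λ σ → 𝟙 (balancedList? l (toList σ)) * matchVec b w σ)
      ≡⟨ ∑-matchVec b w (𝟙 ∘ balancedList? l) ⟩
    weightedSum b w (𝟙 ∘ balancedList? l) ∎
    where open ≡-Reasoning

  -- The word of free letters alone gives the size of the sample space the same form as the pattern
  -- counts, so that `sorted-fall` compares the two.
  length-balanced : ∀ n .{{_ : NonZero n}} → + length (balanced v l n) ≡ sorted b l 0 0 n
  length-balanced n = begin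
    + length (balanced v l n)
      ≡⟨ ℤₚ.*-identityʳ _ ⟨
    + length (balanced v l n) * 1ℤ
      ≡⟨ ∑-const (balanced v l n) 1ℤ ⟨
    ∑ (balanced v l n) (λ _ → 1ℤ)
      ≡⟨ ∑-cong (balanced v l n) (λ σ → match-free b n (at σ)) ⟨
    ∑ (balanced v l n) (λ σ → match b (replicate n free) (at σ))
      ≡⟨ ∑-balanced-match (replicate n free) n (Listₚ.length-replicate n) ⟩
    sorted b l 0 0 n ∎
    where open ≡-Reasoning

length-sortedWord : ∀ r s m → length (sortedWord r s m) ≡ r ℕ.+ s ℕ.+ m
length-sortedWord zero    zero    m = Listₚ.length-replicate m
length-sortedWord zero    (suc s) m = cong suc (length-sortedWord zero s m)
length-sortedWord (suc r) s       m = cong suc (length-sortedWord r s m)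

-- Lists up to permutation form a commutative monoid, so the blocks of hits, misses and free letters
-- can be collected separately.
sortedWord-++ : ∀ r s m r′ s′ m′ →
  sortedWord r s m ++ sortedWord r′ s′ m′ ↭ sortedWord (r ℕ.+ r′) (s ℕ.+ s′) (m ℕ.+ m′)
sortedWord-++ r s m r′ s′ m′ = ↭-trans
  (interchange (replicate r hit) (replicate s miss ++ replicate m free)
               (replicate r′ hit) (replicate s′ miss ++ replicate m′ free))
  (↭ₚ.++⁺ (↭.↭-reflexive (replicate-++ r r′ hit)) (↭-trans
    (interchange (replicate s miss) (replicate m free) (replicate s′ miss) (replicate m′ free))
    (↭.↭-reflexive (cong₂ _++_ (replicate-++ s s′ miss) (replicate-++ m m′ free)))))
  where
  open import Algebra.Properties.CommutativeSemigroup
    (CommutativeMonoid.commutativeSemigroup (↭ₚ.++-commutativeMonoid {A = Letter})) using (interchange)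
  replicate-++ : ∀ m n (p : Letter) → replicate m p ++ replicate n p ≡ replicate (m ℕ.+ n) p
  replicate-++ zero    n p = refl
  replicate-++ (suc m) n p = cong (p ∷_) (replicate-++ m n p)

module _ {v : ℕ} (b : Fin v) (l : ℕ) where

  -- The word is padded with free letters to one full turn and then sorted. Here `e` counts the free
  -- letters already inside it, the gap between two runs; the bound says that the word fits into one
  -- turn, so no position is read twice.
  word-frequency : ∀ {w} r s e n .{{_ : NonZero n}} → w ↭ sortedWord r s e → r ℕ.+ s ℕ.+ e ≤ n →
    ∑ (balanced v l n) (λ σ → match b w (at σ)) * fall (+ n) (r ℕ.+ s) ≡
    fall (+ l) r * fall (+ n - + l) s * + length (balanced v l n)
  word-frequency {w} r s e n w↭ len≤n = begin
    ∑ (balanced v l n) (λ σ → match b w (at σ)) * fall (+ n) (r ℕ.+ s)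
      ≡⟨ cong (_* fall (+ n) (r ℕ.+ s)) (∑-cong (balanced v l n) λ σ → padded (at σ)) ⟨
    ∑ (balanced v l n) (λ σ → match b (w ++ replicate m free) (at σ)) * fall (+ n) (r ℕ.+ s)
      ≡⟨ cong (_* fall (+ n) (r ℕ.+ s)) (trans
           (∑-balanced-match b l (w ++ replicate m free) n len)
           (weightedSum-↭ b (balanced-symmetric l) sort)) ⟩
    sorted b l r s (e ℕ.+ m) * fall (+ n) (r ℕ.+ s)
      ≡⟨ sorted-fall b l r s (e ℕ.+ m) r+s+e+m≡n ⟩
    fall (+ l) r * fall (+ n - + l) s * sorted b l 0 0 n
      ≡⟨ cong (fall (+ l) r * fall (+ n - + l) s *_) (length-balanced b l n) ⟨
    fall (+ l) r * fall (+ n - + l) s * + length (balanced v l n) ∎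
    where
    open ≡-Reasoning
    m = n ∸ (r ℕ.+ s ℕ.+ e)
    r+s+e+m≡n : r ℕ.+ s ℕ.+ (e ℕ.+ m) ≡ n
    r+s+e+m≡n = trans (sym (ℕₚ.+-assoc (r ℕ.+ s) e m)) (ℕₚ.m+[n∸m]≡n len≤n)
    padded : ∀ s → match b (w ++ replicate m free) s ≡ match b w s
    padded s = trans (match-++ b w (replicate m free) s)
      (trans (cong (match b w s *_) (match-free b m _)) (ℤₚ.*-identityʳ _))
    sort : w ++ replicate m free ↭ sortedWord r s (e ℕ.+ m)
    sort = ↭-trans (↭ₚ.++⁺ʳ (replicate m free) w↭) (subst₂
      (λ r′ s′ → sortedWord r s e ++ replicate m free ↭ sortedWord r′ s′ (e ℕ.+ m))
      (ℕₚ.+-identityʳ r) (ℕₚ.+-identityʳ s) (sortedWord-++ r s e 0 0 m))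
    len : length (w ++ replicate m free) ≡ n
    len = trans (↭ₚ.↭-length sort) (trans (length-sortedWord r s (e ℕ.+ m)) r+s+e+m≡n)

-- Moments of the number of runs

runWord : ℕ → Word
runWord t = miss ∷ replicate t hit ++ miss ∷ []

length-runWord : ∀ t → length (runWord t) ≡ suc (suc t)
length-runWord t = cong suc (trans (Listₚ.length-++ (replicate t hit))
  (trans (cong (ℕ._+ 1) (Listₚ.length-replicate t)) (ℕₚ.+-comm t 1)))

runWord-↭ : ∀ t → runWord t ↭ sortedWord t 2 0
runWord-↭ t = ↭-sym (↭ₚ.shift miss (replicate t hit) (miss ∷ []))

adjacentRuns : ℕ → Word
adjacentRuns t = (miss ∷ replicate t hit) ++ runWord t

adjacentRuns-↭ : ∀ t → adjacentRuns t ↭ sortedWord (t ℕ.+ t) 3 0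
adjacentRuns-↭ t = ↭-trans
  (↭ₚ.++⁺ (↭ₚ.∷↭∷ʳ miss (replicate t hit)) (runWord-↭ t))
  (sortedWord-++ t 1 0 t 2 0)

-- The second run word starts at offset t + 2 + e. For `e` zero the closing miss of the first run
-- and the opening miss of the second are neighbours.
separatedRuns : ℕ → ℕ → Word
separatedRuns t e = (runWord t ++ replicate e free) ++ runWord t

separatedRuns-↭ : ∀ t e → separatedRuns t e ↭ sortedWord (t ℕ.+ t) 4 e
separatedRuns-↭ t e = ↭-trans
  (↭ₚ.++⁺ (↭-trans (↭ₚ.++⁺ʳ (replicate e free) (runWord-↭ t))
                   (sortedWord-++ t 2 0 0 0 e))
          (runWord-↭ t))
  (↭-trans (sortedWord-++ (t ℕ.+ 0) 2 e t 2 0)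
    (↭.↭-reflexive (cong₂ (λ r m → sortedWord (r ℕ.+ t) 4 m) (ℕₚ.+-identityʳ t) (ℕₚ.+-identityʳ e))))

-- The run pattern and products of two shifted copies

module _ {v : ℕ} (b : Fin v) where

  -- Stated for an arbitrary decision, so that the induction can pass to a decision for head and
  -- tail without unfolding `allUpTo?`.
  match-hits : ∀ t {s} (hits? : Dec (∀ {ι} → ι < t → s ι ≡ b)) → 𝟙 hits? ≡ match b (replicate t hit) s
  match-hits zero    {s} hits? = 𝟙-cong hits? (ℕₚ.allUpTo? (λ ι → s ι Finₚ.≟ b) 0) id id
  match-hits (suc t) {s} hits? = begin
    𝟙 hits?
      ≡⟨ 𝟙-cong hits? (s 0 Finₚ.≟ b ×-dec tail?)
           (λ h → h (s≤s z≤n) , λ ι<t → h (s≤s ι<t))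
           (λ { (h₀ , h) {zero} _ → h₀ ; (h₀ , h) {suc ι} (s≤s ι<t) → h ι<t }) ⟩
    𝟙 (s 0 Finₚ.≟ b ×-dec tail?)
      ≡⟨ 𝟙-× (s 0 Finₚ.≟ b) tail? ⟩
    weight b hit (s 0) * 𝟙 tail?
      ≡⟨ cong (weight b hit (s 0) *_) (match-hits t tail?) ⟩
    match b (replicate (suc t) hit) s ∎
    where
    open ≡-Reasoning
    tail? = ℕₚ.allUpTo? (λ ι → s (suc ι) Finₚ.≟ b) t

  -- This is the order of the tests in `runAt?`: both boundaries, then the interior.
  match-runWord : ∀ t s → match b (runWord t) s ≡
    weight b miss (s 0) * (weight b miss (s (suc t)) * match b (replicate t hit) (s ∘ suc))
  match-runWord t s = cong (weight b miss (s 0) *_) (begin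
    match b (replicate t hit ++ miss ∷ []) (s ∘ suc)
      ≡⟨ match-++ b (replicate t hit) (miss ∷ []) (s ∘ suc) ⟩
    match b (replicate t hit) (s ∘ suc) * (weight b miss (s (suc (length (replicate t hit) ℕ.+ 0))) * 1ℤ)
      ≡⟨ cong (λ k → match b (replicate t hit) (s ∘ suc) * (weight b miss (s (suc k)) * 1ℤ))
           (trans (ℕₚ.+-identityʳ _) (Listₚ.length-replicate t)) ⟩
    match b (replicate t hit) (s ∘ suc) * (weight b miss (s (suc t)) * 1ℤ)
      ≡⟨ exchange (match b (replicate t hit) (s ∘ suc)) (weight b miss (s (suc t))) ⟩
    weight b miss (s (suc t)) * match b (replicate t hit) (s ∘ suc) ∎)
    where
    open ≡-Reasoning
    exchange : ∀ x y → x * (y * 1ℤ) ≡ y * x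
    exchange = solve-∀

  match-overlap : ∀ {t e} w s → e < t → match b (replicate t hit ++ w) s * weight b miss (s e) ≡ 0ℤ
  match-overlap {suc t} {zero}  w s _ = trans
    (exchange (weight b hit (s 0)) (match b (replicate t hit ++ w) (s ∘ suc)) (weight b miss (s 0)))
    (cong (_* match b (replicate t hit ++ w) (s ∘ suc)) (hit-miss b (s 0)))
    where
    exchange : ∀ x y z → x * y * z ≡ x * z * y
    exchange = solve-∀
  match-overlap {suc t} {suc e} w s (s≤s e<t) = trans
    (ℤₚ.*-assoc (weight b hit (s 0)) _ _)
    (trans (cong (weight b hit (s 0) *_) (match-overlap w (s ∘ suc) e<t)) (ℤₚ.*-zeroʳ (weight b hit (s 0))))

  -- The opening miss of the second copy would fall on the hit of index `e` of the first.
  match-overlappingRuns : ∀ {t e} s → e < t →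
    match b (runWord t) s * match b (runWord t) (λ j → s (suc e ℕ.+ j)) ≡ 0ℤ
  match-overlappingRuns {t} {e} s e<t = begin
    weight b miss (s 0) * X * (weight b miss (s (suc e ℕ.+ 0)) * Y)
      ≡⟨ cong (λ k → weight b miss (s 0) * X * (weight b miss (s k) * Y)) (ℕₚ.+-identityʳ (suc e)) ⟩
    weight b miss (s 0) * X * (weight b miss (s (suc e)) * Y)
      ≡⟨ regroup (weight b miss (s 0)) X (weight b miss (s (suc e))) Y ⟩
    weight b miss (s 0) * (X * weight b miss (s (suc e))) * Y
      ≡⟨ cong (λ x → weight b miss (s 0) * x * Y) (match-overlap (miss ∷ []) (s ∘ suc) e<t) ⟩
    weight b miss (s 0) * 0ℤ * Y
      ≡⟨ cong (_* Y) (ℤₚ.*-zeroʳ (weight b miss (s 0))) ⟩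
    0ℤ ∎
    where
    open ≡-Reasoning
    X = match b (replicate t hit ++ miss ∷ []) (s ∘ suc)
    Y = match b (replicate t hit ++ miss ∷ []) (λ j → s (suc e ℕ.+ suc j))
    regroup : ∀ m x m′ y → m * x * (m′ * y) ≡ m * (x * m′) * y
    regroup = solve-∀

  -- Both factors contain the indicator of the common miss; idempotence removes one of the two.
  match-adjacentRuns : ∀ t s →
    match b (runWord t) s * match b (runWord t) (λ j → s (suc t ℕ.+ j)) ≡ match b (adjacentRuns t) s
  match-adjacentRuns t s = begin
    match b (runWord t) s * (weight b miss (s (suc t ℕ.+ 0)) * Y)
      ≡⟨ cong₂ (λ x k → x * (weight b miss (s k) * Y)) (match-runWord t s) (ℕₚ.+-identityʳ (suc t)) ⟩
    m * (m′ * X) * (m′ * Y)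
      ≡⟨ regroup m m′ X Y ⟩
    m * X * (m′ * m′ * Y)
      ≡⟨ cong (λ x → m * X * (x * Y)) (weight-idem b miss (s (suc t))) ⟩
    m * X * (m′ * Y)
      ≡⟨ cong (λ k → m * X * (weight b miss (s k) * Y)) (ℕₚ.+-identityʳ (suc t)) ⟨
    m * X * match b (runWord t) (λ j → s (suc t ℕ.+ j))
      ≡⟨ cong (λ k → m * X * match b (runWord t) (λ j → s (suc k ℕ.+ j))) (Listₚ.length-replicate t) ⟨
    m * X * match b (runWord t) (λ j → s (suc (length (replicate t hit)) ℕ.+ j))
      ≡⟨ match-++ b (miss ∷ replicate t hit) (runWord t) s ⟨
    match b (adjacentRuns t) s ∎
    where
    open ≡-Reasoning
    m  = weight b miss (s 0)
    m′ = weight b miss (s (suc t))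
    X  = match b (replicate t hit) (s ∘ suc)
    Y  = match b (replicate t hit ++ miss ∷ []) (λ j → s (suc t ℕ.+ suc j))
    regroup : ∀ m m′ x y → m * (m′ * x) * (m′ * y) ≡ m * x * (m′ * m′ * y)
    regroup = solve-∀

  match-separatedRuns : ∀ t e s →
    match b (runWord t) s * match b (runWord t) (λ j → s (suc (suc t) ℕ.+ e ℕ.+ j)) ≡
    match b (separatedRuns t e) s
  match-separatedRuns t e s = begin
    match b (runWord t) s * match b (runWord t) (λ j → s (suc (suc t) ℕ.+ e ℕ.+ j))
      ≡⟨ cong (_* match b (runWord t) (λ j → s (suc (suc t) ℕ.+ e ℕ.+ j))) padded ⟨
    match b (runWord t ++ replicate e free) s * match b (runWord t) (λ j → s (suc (suc t) ℕ.+ e ℕ.+ j))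
      ≡⟨ cong (λ k → match b (runWord t ++ replicate e free) s * match b (runWord t) (λ j → s (k ℕ.+ j))) len ⟨
    match b (runWord t ++ replicate e free) s *
      match b (runWord t) (λ j → s (length (runWord t ++ replicate e free) ℕ.+ j))
      ≡⟨ match-++ b (runWord t ++ replicate e free) (runWord t) s ⟨
    match b (separatedRuns t e) s ∎
    where
    open ≡-Reasoning
    padded : match b (runWord t ++ replicate e free) s ≡ match b (runWord t) s
    padded = trans (match-++ b (runWord t) (replicate e free) s)
      (trans (cong (match b (runWord t) s *_) (match-free b e _)) (ℤₚ.*-identityʳ _))
    len : length (runWord t ++ replicate e free) ≡ suc (suc t) ℕ.+ e
    len = trans (Listₚ.length-++ (runWord t))
      (cong₂ ℕ._+_ (length-runWord t) (Listₚ.length-replicate e))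

-- Runs as occurrences of the run pattern

module _ {v : ℕ} (b : Fin v) (t : ℕ) where

  runFrom : Vec (Fin v) n → .{{NonZero n}} → ℕ → ℤ
  runFrom σ k = match b (runWord t) (λ j → at σ (k ℕ.+ j))

  runFrom-periodic : (σ : Vec (Fin v) n) .{{_ : NonZero n}} (k : ℕ) → runFrom σ (k ℕ.+ n) ≡ runFrom σ k
  runFrom-periodic {n = n} σ k = match-cong b (runWord t) λ j →
    trans (cong (at σ) (swap-right k n j)) (at-periodic σ (k ℕ.+ j))
    where
    swap-right : ∀ k n j → k ℕ.+ n ℕ.+ j ≡ k ℕ.+ j ℕ.+ n
    swap-right k n j = trans (ℕₚ.+-assoc k n j)
      (trans (cong (k ℕ.+_) (ℕₚ.+-comm n j)) (sym (ℕₚ.+-assoc k j n)))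

  -- The reading `s` starts one place before the run and is left abstract, because for `i` zero that
  -- place is reached only by wrapping around.
  runAt-match : (σ : Vec (Fin v) n) .{{_ : NonZero n}} (i : ℤ) (s : ℕ → Fin v) →
    σ ⟨ i - 1ℤ ⟩ ≡ s 0 → (∀ ι → σ ⟨ i + + ι ⟩ ≡ s (suc ι)) →
    𝟙 (runAt? σ b t i) ≡ match b (runWord t) s
  runAt-match σ i s before after = begin
    𝟙 (runAt? σ b t i)
      ≡⟨ 𝟙-× (¬? (σ ⟨ i - 1ℤ ⟩ Finₚ.≟ b)) (¬? (σ ⟨ i + + t ⟩ Finₚ.≟ b) ×-dec hits?) ⟩
    weight b miss (σ ⟨ i - 1ℤ ⟩) * 𝟙 (¬? (σ ⟨ i + + t ⟩ Finₚ.≟ b) ×-dec hits?)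
      ≡⟨ cong (weight b miss (σ ⟨ i - 1ℤ ⟩) *_) (𝟙-× (¬? (σ ⟨ i + + t ⟩ Finₚ.≟ b)) hits?) ⟩
    weight b miss (σ ⟨ i - 1ℤ ⟩) * (weight b miss (σ ⟨ i + + t ⟩) * 𝟙 hits?)
      ≡⟨ cong₂ (λ x y → weight b miss x * (weight b miss y * 𝟙 hits?)) before (after t) ⟩
    weight b miss (s 0) * (weight b miss (s (suc t)) * 𝟙 hits?)
      ≡⟨ cong (λ x → weight b miss (s 0) * (weight b miss (s (suc t)) * x))
           (trans (match-hits b t hits?) (match-cong b (replicate t hit) after)) ⟩
    weight b miss (s 0) * (weight b miss (s (suc t)) * match b (replicate t hit) (s ∘ suc))
      ≡⟨ match-runWord b t s ⟨
    match b (runWord t) s ∎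
    where
    open ≡-Reasoning
    hits? = ℕₚ.allUpTo? (λ ι → σ ⟨ i + + ι ⟩ Finₚ.≟ b) t

  -- A run at `suc k` is an occurrence from `k`, and a run at 0 is an occurrence from the last
  -- index. The two sums thus differ by moving one term from the front to the end.
  ρ≡∑runFrom : (σ : Vec (Fin v) n) .{{_ : NonZero n}} → + ρ σ b t ≡ ∑ (upTo n) (runFrom σ)
  ρ≡∑runFrom {n = suc n} σ = begin
    + ρ σ b t
      ≡⟨ length-filter (λ i → runAt? σ b t {{Finₚ.nonZeroIndex i}} (+ toℕ i)) (allFin (suc n)) ⟩
    ∑ (allFin (suc n)) ((λ k → 𝟙 (runAt? σ b t (+ k))) ∘ toℕ)
      ≡⟨ ∑-allFin (suc n) (λ k → 𝟙 (runAt? σ b t (+ k))) ⟩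
    ∑ (upTo (suc n)) (λ k → 𝟙 (runAt? σ b t (+ k)))
      ≡⟨ ∑-upTo-suc n (λ k → 𝟙 (runAt? σ b t (+ k))) ⟩
    𝟙 (runAt? σ b t (+ 0)) + ∑ (upTo n) (λ k → 𝟙 (runAt? σ b t (+ suc k)))
      ≡⟨ cong₂ _+_ wrap (∑-cong (upTo n) inner) ⟩
    runFrom σ n + ∑ (upTo n) (runFrom σ)
      ≡⟨ ℤₚ.+-comm (runFrom σ n) _ ⟩
    ∑ (upTo n) (runFrom σ) + runFrom σ n
      ≡⟨ trans (+-congˡ (∑ (upTo n) (runFrom σ)) (sym (ℤₚ.+-identityʳ (runFrom σ n))))
           (sym (∑-++ (upTo n) (n ∷ []) (runFrom σ))) ⟩
    ∑ (upTo n List.∷ʳ n) (runFrom σ)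
      ≡⟨ cong (λ ks → ∑ ks (runFrom σ)) (Listₚ.upTo-∷ʳ n) ⟩
    ∑ (upTo (suc n)) (runFrom σ) ∎
    where
    open ≡-Reasoning
    inner : ∀ k → 𝟙 (runAt? σ b t (+ suc k)) ≡ runFrom σ k
    inner k = runAt-match σ (+ suc k) (λ j → at σ (k ℕ.+ j))
      (cong (at σ) (sym (ℕₚ.+-identityʳ k)))
      (λ ι → cong (at σ) (sym (ℕₚ.+-suc k ι)))
    -- The remainder of -1 is computed from that of 1, which is 0 only for length one; hence the
    -- case distinction.
    before : ∀ {n} (σ : Vec (Fin v) (suc n)) → σ ⟨ + 0 - 1ℤ ⟩ ≡ at σ n
    before {zero}  (c ∷ []) = refl
    before {suc n} σ        = cong (lookup σ)
      (Finₚ.fromℕ<-cong _ _ (sym (ℕ.m<n⇒m%n≡m ℕₚ.≤-refl)) (ℕₚ.n<1+n (suc n)) (ℕ.m%n<n (suc n) (suc (suc n))))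
    wrap : 𝟙 (runAt? σ b t (+ 0)) ≡ runFrom σ n
    wrap = runAt-match σ (+ 0) (λ j → at σ (n ℕ.+ j))
      (trans (before σ) (cong (at σ) (sym (ℕₚ.+-identityʳ n))))
      (λ ι → trans (sym (at-periodic σ ι)) (cong (at σ) (trans (ℕₚ.+-suc ι n)
        (trans (cong suc (ℕₚ.+-comm ι n)) (sym (ℕₚ.+-suc n ι))))))

-- Correlation of two occurrences at a given offset

module _ {v : ℕ} (b : Fin v) (l t n : ℕ) .{{_ : NonZero n}} where

  -- The probability c(d) times the number of balanced sequences.
  runCorrelation : ℕ → ℤ
  runCorrelation d = ∑ (balanced v l n) λ σ → runFrom b t σ 0 * runFrom b t σ d

  ∑-runFrom-* : ∀ k d →
    ∑ (balanced v l n) (λ σ → runFrom b t σ k * runFrom b t σ (k ℕ.+ d)) ≡ runCorrelation d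
  ∑-runFrom-* k d = begin
    ∑ (balanced v l n) (λ σ → runFrom b t σ k * runFrom b t σ (k ℕ.+ d))
      ≡⟨ ∑-cong (balanced v l n) (λ σ → cong (runFrom b t σ k *_)
           (match-cong b (runWord t) λ j → cong (at σ) (ℕₚ.+-assoc k d j))) ⟩
    ∑ (balanced v l n) (λ σ → F (λ j → at σ (k ℕ.+ j)))
      ≡⟨ ∑-balanced-shift l n F
           (λ eq → cong₂ _*_ (match-cong b (runWord t) eq) (match-cong b (runWord t) λ j → eq (d ℕ.+ j))) k ⟩
    runCorrelation d ∎
    where
    open ≡-Reasoning
    F : (ℕ → Fin v) → ℤ
    F s = match b (runWord t) s * match b (runWord t) (λ j → s (d ℕ.+ j))

  -- Seen from the second occurrence, the first lies `e` places further on, after a full turn.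
  runCorrelation-reflect : ∀ {d e} → d ℕ.+ e ≡ n → runCorrelation d ≡ runCorrelation e
  runCorrelation-reflect {d} {e} d+e≡n = begin
    runCorrelation d
      ≡⟨ ∑-cong (balanced v l n) (λ σ → trans
           (ℤₚ.*-comm (runFrom b t σ 0) (runFrom b t σ d))
           (cong (runFrom b t σ d *_) (trans (sym (runFrom-periodic b t σ 0))
             (cong (runFrom b t σ) (sym d+e≡n))))) ⟩
    ∑ (balanced v l n) (λ σ → runFrom b t σ d * runFrom b t σ (d ℕ.+ e))
      ≡⟨ ∑-runFrom-* d e ⟩
    runCorrelation e ∎
    where open ≡-Reasoning

  runCorrelation-0 : runCorrelation 0 ≡ ∑ (balanced v l n) (λ σ → match b (runWord t) (at σ))
  runCorrelation-0 = ∑-cong (balanced v l n) λ σ → match-idem b (runWord t) (at σ)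

  runCorrelation-near : ∀ {e} → e < t → runCorrelation (suc e) ≡ 0ℤ
  runCorrelation-near e<t = trans
    (∑-cong (balanced v l n) λ σ → match-overlappingRuns b (at σ) e<t) (∑-zero (balanced v l n))

  first-moment : ∑ (balanced v l n) (λ σ → + ρ σ b t) ≡ + n * runCorrelation 0
  first-moment = begin
    ∑ (balanced v l n) (λ σ → + ρ σ b t)
      ≡⟨ ∑-cong (balanced v l n) (λ σ → ρ≡∑runFrom b t σ) ⟩
    ∑ (balanced v l n) (λ σ → ∑ (upTo n) (runFrom b t σ))
      ≡⟨ ∑-comm (balanced v l n) (upTo n) _ ⟩
    ∑ (upTo n) (λ k → ∑ (balanced v l n) (λ σ → runFrom b t σ k))
      ≡⟨ ∑-upTo-const n (runCorrelation 0) (λ k _ → trans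
           (∑-balanced-shift l n (match b (runWord t)) (match-cong b (runWord t)) k)
           (sym runCorrelation-0)) ⟩
    + n * runCorrelation 0 ∎
    where open ≡-Reasoning

  second-moment : ∑ (balanced v l n) (λ σ → + ρ σ b t * + ρ σ b t) ≡
                  + n * ∑ (upTo n) runCorrelation
  second-moment = begin
    ∑ (balanced v l n) (λ σ → + ρ σ b t * + ρ σ b t)
      ≡⟨ ∑-cong (balanced v l n) square ⟩
    ∑ (balanced v l n) (λ σ → ∑ (upTo n) λ k → ∑ (upTo n) λ d → runFrom b t σ k * runFrom b t σ (k ℕ.+ d))
      ≡⟨ ∑-comm (balanced v l n) (upTo n) _ ⟩
    ∑ (upTo n) (λ k → ∑ (balanced v l n) λ σ → ∑ (upTo n) λ d → runFrom b t σ k * runFrom b t σ (k ℕ.+ d))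
      ≡⟨ ∑-cong (upTo n) (λ k → ∑-comm (balanced v l n) (upTo n) _) ⟩
    ∑ (upTo n) (λ k → ∑ (upTo n) λ d → ∑ (balanced v l n) λ σ → runFrom b t σ k * runFrom b t σ (k ℕ.+ d))
      ≡⟨ ∑-cong (upTo n) (λ k → ∑-cong (upTo n) (∑-runFrom-* k)) ⟩
    ∑ (upTo n) (λ k → ∑ (upTo n) runCorrelation)
      ≡⟨ ∑-upTo-const n (∑ (upTo n) runCorrelation) (λ _ _ → refl) ⟩
    + n * ∑ (upTo n) runCorrelation ∎
    where
    open ≡-Reasoning
    square : ∀ σ → + ρ σ b t * + ρ σ b t ≡
                   ∑ (upTo n) λ k → ∑ (upTo n) λ d → runFrom b t σ k * runFrom b t σ (k ℕ.+ d)
    square σ = begin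
      + ρ σ b t * + ρ σ b t
        ≡⟨ cong₂ _*_ (ρ≡∑runFrom b t σ) (ρ≡∑runFrom b t σ) ⟩
      ∑ (upTo n) (runFrom b t σ) * ∑ (upTo n) (runFrom b t σ)
        ≡⟨ ∑-*ʳ (upTo n) (∑ (upTo n) (runFrom b t σ)) (runFrom b t σ) ⟨
      ∑ (upTo n) (λ k → runFrom b t σ k * ∑ (upTo n) (runFrom b t σ))
        -- Starting the inner sum at `k` replaces the second position by its offset from the first.
        ≡⟨ ∑-cong (upTo n) (λ k → trans
             (cong (runFrom b t σ k *_) (sym (∑-periodic n (runFrom-periodic b t σ) k)))
             (sym (∑-*ˡ (upTo n) (runFrom b t σ k) _))) ⟩
      ∑ (upTo n) (λ k → ∑ (upTo n) λ d → runFrom b t σ k * runFrom b t σ (k ℕ.+ d)) ∎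

  -- The offsets 0, …, n - 1 are split as 1 + t + 1 + q + 1 + t.
  ∑-runCorrelation : ∀ q → suc t ℕ.+ (suc q ℕ.+ suc t) ≡ n →
    ∑ (upTo n) runCorrelation ≡
    runCorrelation 0 + (+ 2 * runCorrelation (suc t) + ∑ (upTo q) λ e → runCorrelation (suc (suc t) ℕ.+ e))
  ∑-runCorrelation q n≡ = begin
    ∑ (upTo n) runCorrelation
      ≡⟨ cong (λ m → ∑ (upTo m) runCorrelation) n≡ ⟨
    ∑ (upTo (suc t ℕ.+ (suc q ℕ.+ suc t))) runCorrelation
      ≡⟨ ∑-upTo-+ (suc t) (suc q ℕ.+ suc t) runCorrelation ⟩
    ∑ (upTo (suc t)) runCorrelation + ∑ (upTo (suc q ℕ.+ suc t)) f
      ≡⟨ cong₂ _+_ low (trans (∑-upTo-+ (suc q) (suc t) f) (cong₂ _+_ middle high)) ⟩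
    runCorrelation 0 + + t * 0ℤ + (runCorrelation (suc t) + far + (runCorrelation (suc t) + + t * 0ℤ))
      ≡⟨ collect (runCorrelation 0) (+ t) (runCorrelation (suc t)) far ⟩
    runCorrelation 0 + (+ 2 * runCorrelation (suc t) + far) ∎
    where
    open ≡-Reasoning
    collect : ∀ x t y z → x + t * 0ℤ + (y + z + (y + t * 0ℤ)) ≡ x + (+ 2 * y + z)
    collect = solve-∀
    far : ℤ
    far = ∑ (upTo q) λ e → runCorrelation (suc (suc t) ℕ.+ e)
    f : ℕ → ℤ
    f k = runCorrelation (suc t ℕ.+ k)
    low : ∑ (upTo (suc t)) runCorrelation ≡ runCorrelation 0 + + t * 0ℤ
    low = trans (∑-upTo-suc t runCorrelation)
      (+-congˡ (runCorrelation 0) (∑-upTo-const t 0ℤ λ e → runCorrelation-near))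
    middle : ∑ (upTo (suc q)) f ≡ runCorrelation (suc t) + far
    middle = trans (∑-upTo-suc q f) (cong₂ _+_ (cong runCorrelation (ℕₚ.+-identityʳ (suc t)))
      (∑-cong (upTo q) λ e → cong runCorrelation (ℕₚ.+-suc (suc t) e)))
    high : ∑ (upTo (suc t)) (λ k → f (suc q ℕ.+ k)) ≡ runCorrelation (suc t) + + t * 0ℤ
    high = trans (∑-upTo-suc t (λ k → f (suc q ℕ.+ k))) (cong₂ _+_
      (runCorrelation-reflect (trans (ℕₚ.+-assoc (suc t) (suc q ℕ.+ 0) (suc t))
        (trans (cong (λ m → suc t ℕ.+ (m ℕ.+ suc t)) (ℕₚ.+-identityʳ (suc q))) n≡)))
      (∑-upTo-const t 0ℤ λ k k<t → trans
        (runCorrelation-reflect {e = t ∸ k} (complement k k<t))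
        (trans (cong runCorrelation (sym (1+pred k k<t)))
          (runCorrelation-near (ℕₚ.<-≤-trans (ℕₚ.≤-reflexive (1+pred k k<t)) (ℕₚ.m∸n≤m t k))))))
      where
      1+pred : ∀ k → k < t → suc (ℕ.pred (t ∸ k)) ≡ t ∸ k
      1+pred k k<t = ℕₚ.suc-pred (t ∸ k) {{ℕ.>-nonZero (ℕₚ.m<n⇒0<n∸m k<t)}}
      complement : ∀ k → k < t → suc t ℕ.+ (suc q ℕ.+ suc k) ℕ.+ (t ∸ k) ≡ n
      complement k k<t = trans (ℕₚ.+-assoc (suc t) (suc q ℕ.+ suc k) (t ∸ k)) (trans
        (cong (suc t ℕ.+_) (trans (ℕₚ.+-assoc (suc q) (suc k) (t ∸ k))
          (cong (λ m → suc q ℕ.+ suc m) (ℕₚ.m+[n∸m]≡n (ℕₚ.<⇒≤ k<t))))) n≡)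

  runCorrelation-0-fall : t ℕ.+ 2 ≤ n →
    runCorrelation 0 * fall (+ n) (t ℕ.+ 2) ≡
    fall (+ l) t * fall (+ n - + l) 2 * + length (balanced v l n)
  runCorrelation-0-fall t+2≤n = trans (cong (_* fall (+ n) (t ℕ.+ 2)) runCorrelation-0)
    (word-frequency b l t 2 0 n (runWord-↭ t) (ℕₚ.≤-trans (ℕₚ.≤-reflexive (ℕₚ.+-identityʳ (t ℕ.+ 2))) t+2≤n))

  runCorrelation-adjacent-fall : t ℕ.+ t ℕ.+ 3 ≤ n →
    runCorrelation (suc t) * fall (+ n) (t ℕ.+ t ℕ.+ 3) ≡
    fall (+ l) (t ℕ.+ t) * fall (+ n - + l) 3 * + length (balanced v l n)
  runCorrelation-adjacent-fall 2t+3≤n = trans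
    (cong (_* fall (+ n) (t ℕ.+ t ℕ.+ 3)) (∑-cong (balanced v l n) λ σ → match-adjacentRuns b t (at σ)))
    (word-frequency b l (t ℕ.+ t) 3 0 n (adjacentRuns-↭ t)
      (ℕₚ.≤-trans (ℕₚ.≤-reflexive (ℕₚ.+-identityʳ (t ℕ.+ t ℕ.+ 3))) 2t+3≤n))

  runCorrelation-separated-fall : ∀ e → t ℕ.+ t ℕ.+ 4 ℕ.+ e ≤ n →
    runCorrelation (suc (suc t) ℕ.+ e) * fall (+ n) (t ℕ.+ t ℕ.+ 4) ≡
    fall (+ l) (t ℕ.+ t) * fall (+ n - + l) 4 * + length (balanced v l n)
  runCorrelation-separated-fall e 2t+4+e≤n = trans
    (cong (_* fall (+ n) (t ℕ.+ t ℕ.+ 4)) (∑-cong (balanced v l n) λ σ → match-separatedRuns b t e (at σ)))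
    (word-frequency b l (t ℕ.+ t) 4 e n (separatedRuns-↭ t e) 2t+4+e≤n)

-- Closed forms of the moments

module _ {v : ℕ} (b : Fin v) (l t n : ℕ) .{{_ : NonZero n}} where

  pos-∸1 : + (n ∸ 1) ≡ + n - 1ℤ
  pos-∸1 = sym (trans (ℤₚ.m-n≡m⊖n n 1) (ℤₚ.⊖-≥ (ℕ.>-nonZero⁻¹ n)))

  -- The number of starting positions supplies the leading factor of (n)_{k+1}, which is why the
  -- final denominators are falling factorials of n - 1.
  n*fall : ∀ k → + n * fall (+ (n ∸ 1)) k ≡ fall (+ n) (suc k)
  n*fall k = trans (cong (λ x → + n * fall x k) pos-∸1) (sym (fall-suc (+ n) k))

  ∑ρ-fall : t ℕ.+ 2 ≤ n →
    ∑ (balanced v l n) (λ σ → + ρ σ b t) * fall (+ (n ∸ 1)) (t ℕ.+ 1) ≡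
    fall (+ l) t * fall (+ n - + l) 2 * + length (balanced v l n)
  ∑ρ-fall t+2≤n = begin
    ∑ (balanced v l n) (λ σ → + ρ σ b t) * f
      ≡⟨ cong (_* f) (first-moment b l t n) ⟩
    + n * runCorrelation b l t n 0 * f
      ≡⟨ regroup (+ n) (runCorrelation b l t n 0) f ⟩
    runCorrelation b l t n 0 * (+ n * f)
      ≡⟨ cong (runCorrelation b l t n 0 *_) (trans (n*fall (t ℕ.+ 1)) (cong (fall (+ n)) (sym (ℕₚ.+-suc t 1)))) ⟩
    runCorrelation b l t n 0 * fall (+ n) (t ℕ.+ 2)
      ≡⟨ runCorrelation-0-fall b l t n t+2≤n ⟩
    fall (+ l) t * fall (+ n - + l) 2 * + length (balanced v l n) ∎
    where
    open ≡-Reasoning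
    f = fall (+ (n ∸ 1)) (t ℕ.+ 1)
    regroup : ∀ n c f → n * c * f ≡ c * (n * f)
    regroup = solve-∀

  -- The total of ρ(ρ - 1), over ordered pairs of distinct runs: subtracting the first moment
  -- removes offset 0.
  pairs : ℤ
  pairs = ∑ (balanced v l n) (λ σ → + ρ σ b t * + ρ σ b t) - ∑ (balanced v l n) (λ σ → + ρ σ b t)

  pairs-fall : t ℕ.+ t ℕ.+ 4 ≤ n →
    pairs * fall (+ (n ∸ 1)) (t ℕ.+ t ℕ.+ 2) ≡
    fall (+ l) (t ℕ.+ t) * (+ 2 * fall (+ n - + l) 3 + fall (+ n - + l) 4) * + length (balanced v l n)
  pairs-fall 2t+4≤n = begin
    pairs * f
      ≡⟨ cong (_* f) (cong₂ _-_ (trans (second-moment b l t n)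
           (cong (+ n *_) (∑-runCorrelation b l t n q n≡))) (first-moment b l t n)) ⟩
    (+ n * (c 0 + (+ 2 * c (suc t) + far)) - + n * c 0) * f
      ≡⟨ regroup (+ n) (c 0) (c (suc t)) far f ⟩
    + 2 * (c (suc t) * (+ n * f)) + far * (+ n * f)
      ≡⟨ cong (λ x → + 2 * (c (suc t) * x) + far * x)
           (trans (n*fall (t ℕ.+ t ℕ.+ 2)) (cong (fall (+ n)) (sym (ℕₚ.+-suc (t ℕ.+ t) 2)))) ⟩
    + 2 * (c (suc t) * fall (+ n) (t ℕ.+ t ℕ.+ 3)) + far * fall (+ n) (t ℕ.+ t ℕ.+ 3)
      ≡⟨ cong₂ (λ x y → + 2 * x + y)
           (runCorrelation-adjacent-fall b l t n (ℕₚ.≤-trans (ℕₚ.+-monoʳ-≤ (t ℕ.+ t) (ℕₚ.n≤1+n 3)) 2t+4≤n))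
           far-fall ⟩
    + 2 * (fall (+ l) (t ℕ.+ t) * fall (+ n - + l) 3 * N) + fall (+ l) (t ℕ.+ t) * fall (+ n - + l) 4 * N
      ≡⟨ collect (fall (+ l) (t ℕ.+ t)) (fall (+ n - + l) 3) (fall (+ n - + l) 4) N ⟩
    fall (+ l) (t ℕ.+ t) * (+ 2 * fall (+ n - + l) 3 + fall (+ n - + l) 4) * N ∎
    where
    open ≡-Reasoning
    c = runCorrelation b l t n
    N = + length (balanced v l n)
    f = fall (+ (n ∸ 1)) (t ℕ.+ t ℕ.+ 2)
    -- This is n - 2t - 3, the number of offsets from t + 2 to n - t - 2. The successor form makes
    -- it visibly nonzero for the cancellation in `far-fall`.
    q = suc (n ∸ (t ℕ.+ t ℕ.+ 4))
    far = ∑ (upTo q) λ e → c (suc (suc t) ℕ.+ e)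
    2t+3+q≡n : t ℕ.+ t ℕ.+ 3 ℕ.+ q ≡ n
    2t+3+q≡n = begin
      t ℕ.+ t ℕ.+ 3 ℕ.+ q                       ≡⟨ ℕₚ.+-suc (t ℕ.+ t ℕ.+ 3) (n ∸ (t ℕ.+ t ℕ.+ 4)) ⟩
      suc (t ℕ.+ t ℕ.+ 3) ℕ.+ (n ∸ (t ℕ.+ t ℕ.+ 4))
        ≡⟨ cong (ℕ._+ (n ∸ (t ℕ.+ t ℕ.+ 4))) (ℕₚ.+-suc (t ℕ.+ t) 3) ⟨
      t ℕ.+ t ℕ.+ 4 ℕ.+ (n ∸ (t ℕ.+ t ℕ.+ 4))   ≡⟨ ℕₚ.m+[n∸m]≡n 2t+4≤n ⟩
      n ∎
    n≡ : suc t ℕ.+ (suc q ℕ.+ suc t) ≡ n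
    n≡ = trans (reorder t q) 2t+3+q≡n
      where
      reorder : ∀ t q → suc t ℕ.+ (suc q ℕ.+ suc t) ≡ t ℕ.+ t ℕ.+ 3 ℕ.+ q
      reorder = ℕ-solve-∀
    far-fall : far * fall (+ n) (t ℕ.+ t ℕ.+ 3) ≡ fall (+ l) (t ℕ.+ t) * fall (+ n - + l) 4 * N
    -- Multiplication by `q` completes (n)_{2t+3} to (n)_{2t+4}, the denominator of each summand of
    -- `far`; the `q` equal summands give the factor back.
    far-fall = ℤₚ.*-cancelʳ-≡ _ _ (+ q) (begin
      far * fall (+ n) (t ℕ.+ t ℕ.+ 3) * + q
        ≡⟨ ℤₚ.*-assoc far _ (+ q) ⟩
      far * (fall (+ n) (t ℕ.+ t ℕ.+ 3) * + q)
        ≡⟨ cong (λ x → far * (fall (+ n) (t ℕ.+ t ℕ.+ 3) * x)) q≡ ⟩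
      far * fall (+ n) (suc (t ℕ.+ t ℕ.+ 3))
        ≡⟨ cong (λ k → far * fall (+ n) k) (ℕₚ.+-suc (t ℕ.+ t) 3) ⟨
      far * fall (+ n) (t ℕ.+ t ℕ.+ 4)
        ≡⟨ ∑-*ʳ (upTo q) (fall (+ n) (t ℕ.+ t ℕ.+ 4)) (λ e → c (suc (suc t) ℕ.+ e)) ⟨
      ∑ (upTo q) (λ e → c (suc (suc t) ℕ.+ e) * fall (+ n) (t ℕ.+ t ℕ.+ 4))
        ≡⟨ ∑-upTo-const q (fall (+ l) (t ℕ.+ t) * fall (+ n - + l) 4 * N)
             (λ e e<q → runCorrelation-separated-fall b l t n e (fits e e<q)) ⟩
      + q * (fall (+ l) (t ℕ.+ t) * fall (+ n - + l) 4 * N)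
        ≡⟨ ℤₚ.*-comm (+ q) _ ⟩
      fall (+ l) (t ℕ.+ t) * fall (+ n - + l) 4 * N * + q ∎)
      where
      q≡ : + q ≡ + n - + (t ℕ.+ t ℕ.+ 3)
      q≡ = trans (cancel (+ (t ℕ.+ t ℕ.+ 3)) (+ q)) (cong (λ m → + m - + (t ℕ.+ t ℕ.+ 3)) 2t+3+q≡n)
        where
        cancel : ∀ x y → y ≡ x + y - x
        cancel = solve-∀
      fits : ∀ e → e < q → t ℕ.+ t ℕ.+ 4 ℕ.+ e ≤ n
      fits e e<q = ℕₚ.≤-trans (ℕₚ.+-monoʳ-≤ (t ℕ.+ t ℕ.+ 4) (ℕ.s≤s⁻¹ e<q))
        (ℕₚ.≤-reflexive (ℕₚ.m+[n∸m]≡n 2t+4≤n))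
    regroup : ∀ n c₀ c₁ g f → (n * (c₀ + (+ 2 * c₁ + g)) - n * c₀) * f ≡ + 2 * (c₁ * (n * f)) + g * (n * f)
    regroup = solve-∀
    collect : ∀ a x y N → + 2 * (a * x * N) + a * y * N ≡ a * (+ 2 * x + y) * N
    collect = solve-∀

-- Fractions

fromℤ : ℤ → ℚ.ℚ
fromℤ i = i / 1

/-cross : ∀ i j d e .{{_ : NonZero d}} .{{_ : NonZero e}} → i * + e ≡ j * + d → i / d ≡ j / e
/-cross i j (suc d) (suc e) eq = ℚₚ.fromℚᵘ-cong {mkℚᵘ i d} {mkℚᵘ j e} (*≡* eq)

-- Since `_/_` reduces to lowest terms, the law is taken from unnormalised fractions, where
-- numerators and denominators stay explicit.
/-+ : ∀ i j d e .{{_ : NonZero d}} .{{_ : NonZero e}} .{{_ : NonZero (d ℕ.* e)}} →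
      i / d ℚ.+ j / e ≡ (i * + e + j * + d) / (d ℕ.* e)
/-+ i j (suc d) (suc e) = ℚₚ.toℚᵘ-injective (ℚᵘₚ.≃-trans
  (ℚₚ.toℚᵘ-homo-+ (i / suc d) (j / suc e)) (ℚᵘₚ.≃-trans
  (ℚᵘₚ.+-cong (ℚₚ.toℚᵘ-fromℚᵘ (mkℚᵘ i d)) (ℚₚ.toℚᵘ-fromℚᵘ (mkℚᵘ j e)))
  (ℚᵘₚ.≃-sym (ℚₚ.toℚᵘ-fromℚᵘ (mkℚᵘ i d ℚᵘ.+ mkℚᵘ j e)))))

/-* : ∀ i j d e .{{_ : NonZero d}} .{{_ : NonZero e}} .{{_ : NonZero (d ℕ.* e)}} →
      i / d ℚ.* (j / e) ≡ (i * j) / (d ℕ.* e)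
/-* i j (suc d) (suc e) = ℚₚ.toℚᵘ-injective (ℚᵘₚ.≃-trans
  (ℚₚ.toℚᵘ-homo-* (i / suc d) (j / suc e)) (ℚᵘₚ.≃-trans
  (ℚᵘₚ.*-cong (ℚₚ.toℚᵘ-fromℚᵘ (mkℚᵘ i d)) (ℚₚ.toℚᵘ-fromℚᵘ (mkℚᵘ j e)))
  (ℚᵘₚ.≃-sym (ℚₚ.toℚᵘ-fromℚᵘ (mkℚᵘ i d ℚᵘ.* mkℚᵘ j e)))))

fromℤ-+ : ∀ i j → fromℤ (i + j) ≡ fromℤ i ℚ.+ fromℤ j
fromℤ-+ i j = trans (cong fromℤ (sym (cong₂ _+_ (ℤₚ.*-identityʳ i) (ℤₚ.*-identityʳ j)))) (sym (/-+ i j 1 1))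

fromℤ-* : ∀ i j → fromℤ (i * j) ≡ fromℤ i ℚ.* fromℤ j
fromℤ-* i j = sym (/-* i j 1 1)

-- The passage from counts to averages: `i` is a total over `N` outcomes, and the hypothesis is its
-- average multiplied out.
fromℤ-average : ∀ i j N d .{{_ : NonZero N}} .{{_ : NonZero d}} →
                i * + d ≡ j * + N → fromℤ i ℚ.* (1ℤ / N) ≡ j / d
fromℤ-average i j N@(suc _) d eq = trans (/-* i 1ℤ 1 N)
  (/-cross (i * 1ℤ) j (1 ℕ.* N) d (trans (cong (_* + d) (ℤₚ.*-identityʳ i))
    (trans eq (cong (λ m → j * + m) (sym (ℕₚ.*-identityˡ N))))))

-- Mean and variance of an integer valued variable

module _ (Ω : List A) .{{nz : NonZero (length Ω)}} (f : A → ℤ) where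

  𝔼-fromℤ : 𝔼 Ω (λ ω → fromℤ (f ω)) ≡ fromℤ (∑ Ω f) ℚ.* (1ℤ / length Ω)
  𝔼-fromℤ = cong (ℚ._* (1ℤ / length Ω)) (sum Ω)
    where
    sum : ∀ xs → List.foldr ℚ._+_ ℚ.0ℚ (List.map (λ ω → fromℤ (f ω)) xs) ≡ fromℤ (∑ xs f)
    sum []       = refl
    sum (x ∷ xs) = trans (cong (ℚ._+_ (fromℤ (f x))) (sum xs)) (sym (fromℤ-+ (f x) (∑ xs f)))

  VAR-fromℤ : VAR Ω (λ ω → fromℤ (f ω)) ≡
    fromℤ (∑ Ω (λ ω → f ω * f ω)) ℚ.* (1ℤ / length Ω) ℚ.- 𝔼 Ω (λ ω → fromℤ (f ω)) ℚ.* 𝔼 Ω (λ ω → fromℤ (f ω))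
  VAR-fromℤ = begin
    VAR Ω (λ ω → fromℤ (f ω))
      ≡⟨ cong (ℚ._* w) (sum Ω) ⟩
    (S₂ ℚ.- (m ℚ.+ m) ℚ.* S₁ ℚ.+ fromℤ (+ length Ω) ℚ.* (m ℚ.* m)) ℚ.* w
      ≡⟨ expand S₂ m S₁ (fromℤ (+ length Ω)) w ⟩
    S₂ ℚ.* w ℚ.- (m ℚ.+ m) ℚ.* (S₁ ℚ.* w) ℚ.+ (fromℤ (+ length Ω) ℚ.* w) ℚ.* (m ℚ.* m)
      ≡⟨ cong₂ (λ x y → S₂ ℚ.* w ℚ.- (m ℚ.+ m) ℚ.* x ℚ.+ y ℚ.* (m ℚ.* m)) (sym 𝔼-fromℤ)
           (fromℤ-average (+ length Ω) 1ℤ (length Ω) 1 (ℤₚ.*-comm (+ length Ω) 1ℤ)) ⟩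
    S₂ ℚ.* w ℚ.- (m ℚ.+ m) ℚ.* m ℚ.+ ℚ.1ℚ ℚ.* (m ℚ.* m)
      ≡⟨ collect (S₂ ℚ.* w) m ⟩
    S₂ ℚ.* w ℚ.- m ℚ.* m ∎
    where
    open ≡-Reasoning
    open ℚ.+-*-Solver
    m  = 𝔼 Ω (λ ω → fromℤ (f ω))
    w  = 1ℤ / length Ω
    S₁ = fromℤ (∑ Ω f)
    S₂ = fromℤ (∑ Ω (λ ω → f ω * f ω))
    expand : ∀ x m y n w → (x ℚ.- (m ℚ.+ m) ℚ.* y ℚ.+ n ℚ.* (m ℚ.* m)) ℚ.* w ≡
                           x ℚ.* w ℚ.- (m ℚ.+ m) ℚ.* (y ℚ.* w) ℚ.+ (n ℚ.* w) ℚ.* (m ℚ.* m)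
    expand = solve 5 (λ x m y n w → (x :- (m :+ m) :* y :+ n :* (m :* m)) :* w :=
                                    x :* w :- (m :+ m) :* (y :* w) :+ (n :* w) :* (m :* m)) refl
    collect : ∀ x m → x ℚ.- (m ℚ.+ m) ℚ.* m ℚ.+ ℚ.1ℚ ℚ.* (m ℚ.* m) ≡ x ℚ.- m ℚ.* m
    collect = solve 2 (λ x m → x :- (m :+ m) :* m :+ con ℚ.1ℚ :* (m :* m) := x :- m :* m) refl
    square : ∀ x m s₂ s₁ n → (x ℚ.- m) ℚ.* (x ℚ.- m) ℚ.+ (s₂ ℚ.- (m ℚ.+ m) ℚ.* s₁ ℚ.+ n ℚ.* (m ℚ.* m)) ≡
      x ℚ.* x ℚ.+ s₂ ℚ.- (m ℚ.+ m) ℚ.* (x ℚ.+ s₁) ℚ.+ (ℚ.1ℚ ℚ.+ n) ℚ.* (m ℚ.* m)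
    square = solve 5 (λ x m s₂ s₁ n → (x :- m) :* (x :- m) :+ (s₂ :- (m :+ m) :* s₁ :+ n :* (m :* m)) :=
      x :* x :+ s₂ :- (m :+ m) :* (x :+ s₁) :+ (con ℚ.1ℚ :+ n) :* (m :* m)) refl
    zeros : ∀ m → ℚ.0ℚ ≡ ℚ.0ℚ ℚ.- (m ℚ.+ m) ℚ.* ℚ.0ℚ ℚ.+ ℚ.0ℚ ℚ.* (m ℚ.* m)
    zeros = solve 1 (λ m → con ℚ.0ℚ := con ℚ.0ℚ :- (m :+ m) :* con ℚ.0ℚ :+ con ℚ.0ℚ :* (m :* m)) refl
    -- The mean `m` of the whole of `Ω` stays fixed while `xs` varies, so this expands the squared
    -- deviations from a constant.
    sum : ∀ xs → List.foldr ℚ._+_ ℚ.0ℚ (List.map (λ ω → (fromℤ (f ω) ℚ.- m) ℚ.* (fromℤ (f ω) ℚ.- m)) xs) ≡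
      fromℤ (∑ xs (λ ω → f ω * f ω)) ℚ.- (m ℚ.+ m) ℚ.* fromℤ (∑ xs f) ℚ.+ fromℤ (+ length xs) ℚ.* (m ℚ.* m)
    sum []       = zeros m
    sum (x ∷ xs) = begin
      (y ℚ.- m) ℚ.* (y ℚ.- m) ℚ.+ List.foldr ℚ._+_ ℚ.0ℚ (List.map (λ ω → (fromℤ (f ω) ℚ.- m) ℚ.* (fromℤ (f ω) ℚ.- m)) xs)
        ≡⟨ cong (ℚ._+_ ((y ℚ.- m) ℚ.* (y ℚ.- m))) (sum xs) ⟩
      (y ℚ.- m) ℚ.* (y ℚ.- m) ℚ.+
        (fromℤ s₂ ℚ.- (m ℚ.+ m) ℚ.* fromℤ s₁ ℚ.+ fromℤ (+ length xs) ℚ.* (m ℚ.* m))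
        ≡⟨ square y m (fromℤ s₂) (fromℤ s₁) (fromℤ (+ length xs)) ⟩
      y ℚ.* y ℚ.+ fromℤ s₂ ℚ.- (m ℚ.+ m) ℚ.* (y ℚ.+ fromℤ s₁) ℚ.+ (ℚ.1ℚ ℚ.+ fromℤ (+ length xs)) ℚ.* (m ℚ.* m)
        ≡⟨ cong₂ (λ a b → a ℚ.- (m ℚ.+ m) ℚ.* (y ℚ.+ fromℤ s₁) ℚ.+ b ℚ.* (m ℚ.* m))
             (trans (fromℤ-+ (f x * f x) s₂) (cong (ℚ._+ fromℤ s₂) (fromℤ-* (f x) (f x))))
             (fromℤ-+ 1ℤ (+ length xs)) ⟨
      fromℤ (f x * f x + s₂) ℚ.- (m ℚ.+ m) ℚ.* (y ℚ.+ fromℤ s₁) ℚ.+ fromℤ (+ length (x ∷ xs)) ℚ.* (m ℚ.* m)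
        ≡⟨ cong (λ a → fromℤ (f x * f x + s₂) ℚ.- (m ℚ.+ m) ℚ.* a ℚ.+ fromℤ (+ length (x ∷ xs)) ℚ.* (m ℚ.* m))
             (fromℤ-+ (f x) s₁) ⟨
      fromℤ (f x * f x + s₂) ℚ.- (m ℚ.+ m) ℚ.* fromℤ (f x + s₁) ℚ.+ fromℤ (+ length (x ∷ xs)) ℚ.* (m ℚ.* m) ∎
      where
      y  = fromℤ (f x)
      s₁ = ∑ xs f
      s₂ = ∑ xs (λ ω → f ω * f ω)

-- The parameter ranges

module _ {v l t : ℕ} (v≥2 : v ≥ 2) (t≥1 : t ≥ 1) (n≥2vt : v ℕ.* l ≥ 2 ℕ.* v ℕ.* t) where

  2t≤l : 2 ℕ.* t ≤ l
  2t≤l = ℕₚ.*-cancelˡ-≤ v {{ℕ.>-nonZero (ℕₚ.<-≤-trans (s≤s z≤n) v≥2)}} (begin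
    v ℕ.* (2 ℕ.* t)   ≡⟨ ℕₚ.*-assoc v 2 t ⟨
    v ℕ.* 2 ℕ.* t     ≡⟨ cong (ℕ._* t) (ℕₚ.*-comm v 2) ⟩
    2 ℕ.* v ℕ.* t     ≤⟨ n≥2vt ⟩
    v ℕ.* l           ∎)
    where open ℕₚ.≤-Reasoning

  t+t≤l : t ℕ.+ t ≤ l
  t+t≤l = ℕₚ.≤-trans (ℕₚ.≤-reflexive (cong (t ℕ.+_) (sym (ℕₚ.+-identityʳ t)))) 2t≤l

  t≤l : t ≤ l
  t≤l = ℕₚ.≤-trans (ℕₚ.m≤m+n t t) t+t≤l

  2≤l : 2 ≤ l
  2≤l = ℕₚ.≤-trans (ℕₚ.+-mono-≤ t≥1 t≥1) t+t≤l

  l+l≤vl : l ℕ.+ l ≤ v ℕ.* l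
  l+l≤vl = ℕₚ.≤-trans (ℕₚ.≤-reflexive (cong (l ℕ.+_) (sym (ℕₚ.+-identityʳ l)))) (ℕₚ.*-monoˡ-≤ l v≥2)

  t+2≤vl : t ℕ.+ 2 ≤ v ℕ.* l
  t+2≤vl = ℕₚ.≤-trans (ℕₚ.+-mono-≤ t≤l 2≤l) l+l≤vl

  -- For `v ≥ 3`, three copies of `l` cover 2t, 2 and 2. For `v` equal to 2 the claim reduces to
  -- `t + 2 ≤ l`: if `t ≥ 2` this follows from `t + t ≤ l`, and if `t` is 1 it fails only at `l`
  -- equal to 2, the excluded case.
  t+t+4≤vl : ¬ (v ≡ 2 × l ≡ 2 × t ≡ 1) → t ℕ.+ t ℕ.+ 4 ≤ v ℕ.* l
  t+t+4≤vl ≢221 with ℕₚ.m≤n⇒m<n∨m≡n v≥2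
  ... | inj₁ v≥3 = begin
    t ℕ.+ t ℕ.+ 4         ≤⟨ ℕₚ.+-mono-≤ t+t≤l (ℕₚ.+-mono-≤ 2≤l (ℕₚ.+-mono-≤ 2≤l (z≤n {0}))) ⟩
    3 ℕ.* l               ≤⟨ ℕₚ.*-monoˡ-≤ l v≥3 ⟩
    v ℕ.* l               ∎
    where open ℕₚ.≤-Reasoning
  ... | inj₂ refl = begin
    t ℕ.+ t ℕ.+ 4             ≡⟨ regroup t ⟩
    t ℕ.+ 2 ℕ.+ (t ℕ.+ 2)     ≤⟨ ℕₚ.+-mono-≤ t+2≤l t+2≤l ⟩
    l ℕ.+ l                   ≤⟨ l+l≤vl ⟩
    2 ℕ.* l                   ∎
    where
    open ℕₚ.≤-Reasoning
    regroup : ∀ t → t ℕ.+ t ℕ.+ 4 ≡ t ℕ.+ 2 ℕ.+ (t ℕ.+ 2)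
    regroup = ℕ-solve-∀
    t+2≤l : t ℕ.+ 2 ≤ l
    t+2≤l with ℕₚ.m≤n⇒m<n∨m≡n t≥1
    ... | inj₁ t≥2  = ℕₚ.≤-trans (ℕₚ.+-monoʳ-≤ t t≥2) t+t≤l
    ... | inj₂ refl = ℕₚ.≤∧≢⇒< 2≤l λ 2≡l → ≢221 (refl , sym 2≡l , refl)

other-symbols : ∀ v l → + (v ℕ.* l) - + l ≡ + l * (+ v - 1ℤ)
other-symbols v l = trans (cong (_- + l) (ℤₚ.pos-* v l)) (factor (+ v) (+ l))
  where
  factor : ∀ v l → v * l - l ≡ l * (v - 1ℤ)
  factor = solve-∀

-- Mean and variance of the number of runs

theorem6 : ∀ (v l t : ℕ) (v≥2 : v ≥ 2) (l≥1 : l ≥ 1) (t≥1 : t ≥ 1)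
    (n≥2vt : v ℕ.* l ≥ 2 ℕ.* v ℕ.* t) (b : Fin v) →
    let n = v ℕ.* l
        X = λ σ → + ρ σ b t / 1
        μ = ( (+ l * (+ v - 1ℤ) - 1ℤ) * (+ v - 1ℤ) * + l * + (l P t)
            / ((n ∸ 1) P (t ℕ.+ 1)) ) {{mean-denominator v≥2 t≥1 n≥2vt}}
    in
      𝔼 (B v l) {{B-nonEmpty v l}} X ≡ μ
      × ((≢221 : ¬ (v ≡ 2 × l ≡ 2 × t ≡ 1)) →
         VAR (B v l) {{B-nonEmpty v l}} X ≡
           μ ℚ.- μ ℚ.* μ
           ℚ.+ ( (+ v - 1ℤ) * + l * + (l P (2 ℕ.* t))
                 * (+ l * (+ v - 1ℤ) - 1ℤ) ^ 2 * (+ l * (+ v - 1ℤ) - + 2)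
               / ((n ∸ 1) P (2 ℕ.* t ℕ.+ 2)) )
               {{variance-denominator v≥2 t≥1 n≥2vt ≢221}})
theorem6 v l t v≥2 l≥1 t≥1 n≥2vt b = mean , variance
  where
  open ≡-Reasoning
  L = v ℕ.* l
  Ω = B v l
  instance
    n≢0 : NonZero L
    n≢0 = ℕ.>-nonZero (ℕₚ.<-≤-trans (s≤s z≤n) (ℕₚ.≤-trans (ℕₚ.m≤n+m 2 t) (t+2≤vl v≥2 t≥1 n≥2vt)))
    Ω≢0 : NonZero (length Ω)
    Ω≢0 = B-nonEmpty v l
    d₁≢0 : NonZero ((L ∸ 1) P (t ℕ.+ 1))
    d₁≢0 = mean-denominator v≥2 t≥1 n≥2vt
  r : Vec (Fin v) L → ℤ
  r σ = + ρ σ b t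
  a₁ = (+ l * (+ v - 1ℤ) - 1ℤ) * (+ v - 1ℤ) * + l * + (l P t)
  a₂ = (+ v - 1ℤ) * + l * + (l P (2 ℕ.* t)) * (+ l * (+ v - 1ℤ) - 1ℤ) ^ 2 * (+ l * (+ v - 1ℤ) - + 2)
  w = 1ℤ / length Ω
  N = + length Ω

  first : fromℤ (∑ Ω r) ℚ.* w ≡ a₁ / ((L ∸ 1) P (t ℕ.+ 1))
  first = fromℤ-average (∑ Ω r) a₁ (length Ω) ((L ∸ 1) P (t ℕ.+ 1)) (begin
    ∑ Ω r * + ((L ∸ 1) P (t ℕ.+ 1))
      ≡⟨ cong (∑ Ω r *_) (P≡fall t+1≤L-1) ⟩
    ∑ Ω r * fall (+ (L ∸ 1)) (t ℕ.+ 1)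
      ≡⟨ ∑ρ-fall b l t L (t+2≤vl v≥2 t≥1 n≥2vt) ⟩
    fall (+ l) t * fall (+ L - + l) 2 * N
      ≡⟨ cong₂ (λ x y → x * fall y 2 * N) (sym (P≡fall (t≤l v≥2 t≥1 n≥2vt))) (other-symbols v l) ⟩
    + (l P t) * fall (+ l * (+ v - 1ℤ)) 2 * N
      ≡⟨ expand (+ (l P t)) (+ l) (+ v) N ⟩
    a₁ * N ∎)
    where
    t+1≤L-1 : t ℕ.+ 1 ≤ L ∸ 1
    t+1≤L-1 = ℕₚ.∸-monoˡ-≤ 1 (ℕₚ.≤-trans (ℕₚ.≤-reflexive (sym (ℕₚ.+-suc t 1))) (t+2≤vl v≥2 t≥1 n≥2vt))
    expand : ∀ p l v N → p * (1ℤ * (l * (v - 1ℤ) - + 0) * (l * (v - 1ℤ) - 1ℤ)) * N ≡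
                         (l * (v - 1ℤ) - 1ℤ) * (v - 1ℤ) * l * p * N
    expand = solve-∀

  mean : 𝔼 Ω (λ σ → fromℤ (r σ)) ≡ a₁ / ((L ∸ 1) P (t ℕ.+ 1))
  mean = trans (𝔼-fromℤ Ω r) first

  module _ (≢221 : ¬ (v ≡ 2 × l ≡ 2 × t ≡ 1)) where
    instance
      d₂≢0 : NonZero ((L ∸ 1) P (2 ℕ.* t ℕ.+ 2))
      d₂≢0 = variance-denominator v≥2 t≥1 n≥2vt ≢221
    fits = t+t+4≤vl v≥2 t≥1 n≥2vt ≢221
    D = pairs b l t L
    2t≡t+t : 2 ℕ.* t ≡ t ℕ.+ t
    2t≡t+t = cong (t ℕ.+_) (ℕₚ.+-identityʳ t)

    second : fromℤ D ℚ.* w ≡ a₂ / ((L ∸ 1) P (2 ℕ.* t ℕ.+ 2))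
    second = fromℤ-average D a₂ (length Ω) ((L ∸ 1) P (2 ℕ.* t ℕ.+ 2)) (begin
      D * + ((L ∸ 1) P (2 ℕ.* t ℕ.+ 2))
        ≡⟨ cong (λ k → D * + ((L ∸ 1) P (k ℕ.+ 2))) 2t≡t+t ⟩
      D * + ((L ∸ 1) P (t ℕ.+ t ℕ.+ 2))
        ≡⟨ cong (D *_) (P≡fall 2t+2≤L-1) ⟩
      D * fall (+ (L ∸ 1)) (t ℕ.+ t ℕ.+ 2)
        ≡⟨ pairs-fall b l t L fits ⟩
      fall (+ l) (t ℕ.+ t) * (+ 2 * fall (+ L - + l) 3 + fall (+ L - + l) 4) * N
        ≡⟨ cong₂ (λ x y → x * (+ 2 * fall y 3 + fall y 4) * N)
             (trans (sym (P≡fall (t+t≤l v≥2 t≥1 n≥2vt))) (cong (λ k → + (l P k)) (sym 2t≡t+t)))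
             (other-symbols v l) ⟩
      + (l P (2 ℕ.* t)) * (+ 2 * fall (+ l * (+ v - 1ℤ)) 3 + fall (+ l * (+ v - 1ℤ)) 4) * N
        ≡⟨ expand (+ (l P (2 ℕ.* t))) (+ l) (+ v - 1ℤ) N ⟩
      a₂ * N ∎)
      where
      2t+2≤L-1 : t ℕ.+ t ℕ.+ 2 ≤ L ∸ 1
      2t+2≤L-1 = ℕₚ.∸-monoˡ-≤ 1 (ℕₚ.≤-trans
        (ℕₚ.≤-reflexive (sym (ℕₚ.+-suc (t ℕ.+ t) 2)))
        (ℕₚ.≤-trans (ℕₚ.+-monoʳ-≤ (t ℕ.+ t) (ℕₚ.n≤1+n 3)) fits))
      -- With m = lu the bracket is 2(m)_3 + (m)_4 = (m)_3 (2 + m - 3) = m (m - 1)² (m - 2), the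
      -- origin of the square in the variance.
      expand : ∀ p l u N →
        p * (+ 2 * (1ℤ * (l * u - + 0) * (l * u - 1ℤ) * (l * u - + 2)) +
             1ℤ * (l * u - + 0) * (l * u - 1ℤ) * (l * u - + 2) * (l * u - + 3)) * N ≡
        u * l * p * ((l * u - 1ℤ) * ((l * u - 1ℤ) * 1ℤ)) * (l * u - + 2) * N
      expand = solve-∀

    variance : VAR Ω (λ σ → fromℤ (r σ)) ≡
      a₁ / ((L ∸ 1) P (t ℕ.+ 1)) ℚ.- a₁ / ((L ∸ 1) P (t ℕ.+ 1)) ℚ.* (a₁ / ((L ∸ 1) P (t ℕ.+ 1)))
      ℚ.+ a₂ / ((L ∸ 1) P (2 ℕ.* t ℕ.+ 2))
    variance = begin
      VAR Ω (λ σ → fromℤ (r σ))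
        ≡⟨ VAR-fromℤ Ω r ⟩
      fromℤ S₂ ℚ.* w ℚ.- 𝔼 Ω (λ σ → fromℤ (r σ)) ℚ.* 𝔼 Ω (λ σ → fromℤ (r σ))
        ≡⟨ cong₂ (λ x y → x ℚ.- y ℚ.* y) split mean ⟩
      μ ℚ.+ p ℚ.- μ ℚ.* μ
        ≡⟨ reorder μ p (μ ℚ.* μ) ⟩
      μ ℚ.- μ ℚ.* μ ℚ.+ p ∎
      where
      μ = a₁ / ((L ∸ 1) P (t ℕ.+ 1))
      p = a₂ / ((L ∸ 1) P (2 ℕ.* t ℕ.+ 2))
      S₂ = ∑ Ω (λ σ → r σ * r σ)
      -- E(ρ²) = E(ρ) + E(ρ(ρ - 1)), with `D` as the total for the second summand.
      split : fromℤ S₂ ℚ.* w ≡ μ ℚ.+ p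
      split = begin
        fromℤ S₂ ℚ.* w                          ≡⟨ cong (λ x → fromℤ x ℚ.* w) (complement S₂ (∑ Ω r)) ⟩
        fromℤ (∑ Ω r + D) ℚ.* w                 ≡⟨ cong (ℚ._* w) (fromℤ-+ (∑ Ω r) D) ⟩
        (fromℤ (∑ Ω r) ℚ.+ fromℤ D) ℚ.* w       ≡⟨ ℚₚ.*-distribʳ-+ w (fromℤ (∑ Ω r)) (fromℤ D) ⟩
        fromℤ (∑ Ω r) ℚ.* w ℚ.+ fromℤ D ℚ.* w   ≡⟨ cong₂ ℚ._+_ first second ⟩
        μ ℚ.+ p                                 ∎
        where
        complement : ∀ x y → x ≡ y + (x - y)
        complement = solve-∀
      reorder : ∀ x y z → x ℚ.+ y ℚ.- z ≡ x ℚ.- z ℚ.+ y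
      reorder = solve 3 (λ x y z → x :+ y :- z := x :- z :+ y) refl
        where open ℚ.+-*-Solver
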